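{- Let $x\geq 4$ be an even integer. Then there exists a standard linear realization of $\{1^a,x^b,(x+1)^c\}$ in each of the following cases: (1) $b,c\geq 0$ and $a\geq 3x-1$; (2) $b,c\geq 0$ and $a\geq c+2x-1$; (3) $b\geq c\geq 0$ and $a\geq 2x-1$.
   Context: The notation $\{1^{a_1},\ldots,t^{a_t}\}$ denotes the multiset with $a_i$ copies of $i$. For a list (multiset) $L$ of positive integers with $|L|$ elements, a linear realization of $L$ is an ordering $[x_0,\ldots,x_{|L|}]$ of $\{0,1,\ldots,|L|\}$ such that the multiset $\{|x_i-x_{i+1}|:0\le i\le |L|-1\}$ equals $L$; it is standard if $x_0=0$. All exponents are integers. -}

module Defs where

open import Data.Nat using (ℕ; zero; suc; _+_; _∸_)
open import Data.List using (List; []; _∷_; length; upTo; replicate; _++_)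
open import Data.List.Relation.Binary.Permutation.Propositional using (_↭_)
open import Data.Product using (_×_)
open import Relation.Binary.PropositionalEquality using (_≡_)

absDiff : ℕ → ℕ → ℕ
absDiff m n = (m ∸ n) + (n ∸ m)

diffs : List ℕ → List ℕ
diffs []           = []
diffs (_ ∷ [])     = []
diffs (x ∷ y ∷ xs) = absDiff x y ∷ diffs (y ∷ xs)

LinearRealization : List ℕ → List ℕ → Set
LinearRealization L xs = (xs ↭ upTo (suc (length L))) × (diffs xs ↭ L)

StandardLinearRealization : List ℕ → List ℕ → Set
StandardLinearRealization L []       = LinearRealization L []
StandardLinearRealization L (x ∷ xs) = LinearRealization L (x ∷ xs) × (x ≡ 0)

L1xx1 : ℕ → ℕ → ℕ → ℕ → List ℕ
L1xx1 x a b c = replicate a 1 ++ replicate b x ++ replicate c (suc x)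

module Submission where

-- Realizations are assembled from perfect pieces, which start at 0 and end at their maximum and so can
-- be concatenated (shifting the second one up), followed by one final piece.  Perfect pieces are runs of
-- unit steps; the zigzag 0, x+1, 1, x+2, ..., x, 2x+1, with x steps x and x + 1 steps x + 1; and snakes
-- through the columns c, c + (x+1), c + 2(x+1), ... of [0, N], giving full rows of (x + 1)-steps at the
-- cost of x unit steps.  The final piece is a snake through the columns modulo x, run alternately up and
-- down and joined by unit steps; it realizes any number of x-steps with x - 1 unit steps, in one of two
-- column orders according to the parity of the number of cells in the last row.  Splicing a new value
-- j ≤ x into the junction of columns j - 1 and j turns the j vertical steps crossing it into (x + 1)-steps,
-- and inserting a new maximum next to the old one turns one x-step into a unit step and an (x + 1)-step.
-- This yields every remainder of (x + 1)-steps with at most x + 1 unit steps, up to two parity cases that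
-- a further perfect piece repairs; counting unit steps gives the three bounds on a.

open import Data.Bool using (Bool; true; false; not; if_then_else_)
import Data.Bool.Properties as Bool
open import Data.Empty using (⊥-elim)
open import Data.List using (List; []; _∷_; _++_; map; concat; length; replicate; upTo; applyUpTo; reverse; [_]; _∷ʳ_)
import Data.List.Properties as List
open import Data.List.Membership.Propositional using (_∈_)
import Data.List.Membership.Propositional.Properties as ∈
open import Data.List.Relation.Unary.All as All using (All; []; _∷_)
import Data.List.Relation.Unary.All.Properties as Allₚ
open import Data.List.Relation.Unary.Any using (here; there)
open import Data.List.Relation.Binary.Permutation.Propositional
  using (_↭_; ↭-refl; ↭-sym; ↭-trans; ↭-reflexive; prep; swap; module PermutationReasoning)
import Data.List.Relation.Binary.Permutation.Propositional as Perm
import Data.List.Relation.Binary.Permutation.Propositional.Properties as ↭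
open import Data.Nat using (ℕ; zero; suc; _+_; _*_; _∸_; _≤_; _<_; z≤n; s≤s; _<ᵇ_)
import Data.Nat.Properties as ℕ
open import Data.Nat.Divisibility using (_∣_; divides)
open import Data.Nat.DivMod using (_/_; _%_; m≡m%n+[m/n]*n; m%n<n)
open import Data.Nat.Tactic.RingSolver using (solve-∀)
open import Data.Product using (Σ; ∃; ∃₂; _×_; _,_; proj₁; proj₂; uncurry)
open import Data.Sum using (_⊎_; inj₁; inj₂)
import Data.Sum as Sum
open import Function using (_∘_)
open import Relation.Nullary using (yes; no)
open import Relation.Binary.PropositionalEquality
  using (_≡_; _≢_; refl; sym; trans; cong; cong₂; subst; module ≡-Reasoning)

open import Defs

absDiff-comm : ∀ u w → absDiff u w ≡ absDiff w u
absDiff-comm u w = ℕ.+-comm (u ∸ w) (w ∸ u)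

absDiff-+ʳ : ∀ u k → absDiff u (k + u) ≡ k
absDiff-+ʳ u k = cong₂ _+_ (ℕ.m≤n⇒m∸n≡0 (ℕ.m≤n+m u k)) (ℕ.m+n∸n≡m k u)

absDiff-+ˡ : ∀ u k → absDiff (k + u) u ≡ k
absDiff-+ˡ u k = trans (absDiff-comm (k + u) u) (absDiff-+ʳ u k)

absDiff-+-cancelˡ : ∀ k u w → absDiff (k + u) (k + w) ≡ absDiff u w
absDiff-+-cancelˡ k u w = cong₂ _+_ (ℕ.[m+n]∸[m+o]≡n∸o k u w) (ℕ.[m+n]∸[m+o]≡n∸o k w u)

absDiff-suc : ∀ u → absDiff u (suc u) ≡ 1
absDiff-suc u = absDiff-+ʳ u 1

absDiff-sucˡ : ∀ u → absDiff (suc u) u ≡ 1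
absDiff-sucˡ u = absDiff-+ˡ u 1

pairDiff : ℕ × ℕ → ℕ
pairDiff = uncurry absDiff

headD : List ℕ → ℕ
headD []      = 0
headD (x ∷ _) = x

lastD : List ℕ → ℕ
lastD []           = 0
lastD (x ∷ [])     = x
lastD (_ ∷ y ∷ xs) = lastD (y ∷ xs)

data NonEmpty : List ℕ → Set where
  nonEmpty : ∀ x xs → NonEmpty (x ∷ xs)

NonEmpty-++ : ∀ xs ys → NonEmpty xs → NonEmpty (xs ++ ys)
NonEmpty-++ (x ∷ xs) ys _ = nonEmpty x (xs ++ ys)

NonEmpty-map : ∀ (f : ℕ → ℕ) xs → NonEmpty xs → NonEmpty (map f xs)
NonEmpty-map f (x ∷ xs) _ = nonEmpty (f x) (map f xs)

NonEmpty-∷ʳ : ∀ xs u → NonEmpty (xs ∷ʳ u)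
NonEmpty-∷ʳ []       u = nonEmpty u []
NonEmpty-∷ʳ (x ∷ xs) u = nonEmpty x _

headD-++ : ∀ xs ys → NonEmpty xs → headD (xs ++ ys) ≡ headD xs
headD-++ (x ∷ xs) ys _ = refl

headD-map : ∀ (f : ℕ → ℕ) xs → NonEmpty xs → headD (map f xs) ≡ f (headD xs)
headD-map f (x ∷ xs) _ = refl

headD-middle : ∀ xs u ys zs → headD (xs ++ u ∷ ys) ≡ headD (xs ++ u ∷ zs)
headD-middle []       u ys zs = refl
headD-middle (x ∷ xs) u ys zs = refl

lastD-++ : ∀ xs ys → NonEmpty ys → lastD (xs ++ ys) ≡ lastD ys
lastD-++ []            ys _ = refl
lastD-++ (x ∷ [])      (y ∷ ys) _ = refl
lastD-++ (x ∷ x′ ∷ xs) ys ne = lastD-++ (x′ ∷ xs) ys ne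

lastD-∷ʳ : ∀ xs u → lastD (xs ∷ʳ u) ≡ u
lastD-∷ʳ xs u = lastD-++ xs [ u ] (nonEmpty u [])

lastD-map : ∀ (f : ℕ → ℕ) xs → NonEmpty xs → lastD (map f xs) ≡ f (lastD xs)
lastD-map f (x ∷ [])     _ = refl
lastD-map f (x ∷ y ∷ xs) _ = lastD-map f (y ∷ xs) (nonEmpty y xs)

lastD-reverse : ∀ xs → lastD (reverse xs) ≡ headD xs
lastD-reverse []       = refl
lastD-reverse (x ∷ xs) = trans (cong lastD (List.unfold-reverse x xs)) (lastD-∷ʳ (reverse xs) x)

headD-reverse : ∀ xs → headD (reverse xs) ≡ lastD xs
headD-reverse xs = trans (sym (lastD-reverse (reverse xs))) (cong lastD (List.reverse-involutive xs))

steps : List ℕ → List (ℕ × ℕ)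
steps []           = []
steps (_ ∷ [])     = []
steps (x ∷ y ∷ xs) = (x , y) ∷ steps (y ∷ xs)

diffs≡map-pairDiff-steps : ∀ xs → diffs xs ≡ map pairDiff (steps xs)
diffs≡map-pairDiff-steps []           = refl
diffs≡map-pairDiff-steps (_ ∷ [])     = refl
diffs≡map-pairDiff-steps (x ∷ y ∷ xs) = cong (absDiff x y ∷_) (diffs≡map-pairDiff-steps (y ∷ xs))

steps-++ : ∀ xs y ys → NonEmpty xs → steps (xs ++ y ∷ ys) ≡ steps xs ++ (lastD xs , y) ∷ steps (y ∷ ys)
steps-++ (x ∷ [])      y ys _ = refl
steps-++ (x ∷ x′ ∷ xs) y ys _ = cong ((x , x′) ∷_) (steps-++ (x′ ∷ xs) y ys (nonEmpty x′ xs))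

steps-map : ∀ (f : ℕ → ℕ) xs → steps (map f xs) ≡ map (λ p → (f (proj₁ p) , f (proj₂ p))) (steps xs)
steps-map f []           = refl
steps-map f (x ∷ [])     = refl
steps-map f (x ∷ y ∷ xs) = cong ((f x , f y) ∷_) (steps-map f (y ∷ xs))

steps-middle : ∀ xs u ys → steps (xs ++ u ∷ ys) ≡ steps (xs ∷ʳ u) ++ steps (u ∷ ys)
steps-middle []            u ys = refl
steps-middle (x ∷ [])      u ys = refl
steps-middle (x ∷ x′ ∷ xs) u ys = cong ((x , x′) ∷_) (steps-middle (x′ ∷ xs) u ys)

diffs-middle : ∀ xs u v ys → diffs (xs ++ u ∷ v ∷ ys) ↭ absDiff u v ∷ (diffs (xs ∷ʳ u) ++ diffs (v ∷ ys))
diffs-middle xs u v ys = begin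
    diffs (xs ++ u ∷ v ∷ ys)
      ≡⟨ trans (diffs≡map-pairDiff-steps _) (cong (map pairDiff) (steps-middle xs u (v ∷ ys))) ⟩
    map pairDiff (steps (xs ∷ʳ u) ++ (u , v) ∷ steps (v ∷ ys))
      ≡⟨ List.map-++ pairDiff (steps (xs ∷ʳ u)) _ ⟩
    map pairDiff (steps (xs ∷ʳ u)) ++ absDiff u v ∷ map pairDiff (steps (v ∷ ys))
      ↭⟨ ↭.shift (absDiff u v) (map pairDiff (steps (xs ∷ʳ u))) _ ⟩
    absDiff u v ∷ (map pairDiff (steps (xs ∷ʳ u)) ++ map pairDiff (steps (v ∷ ys)))
      ≡⟨ sym (cong₂ (λ s t → absDiff u v ∷ (s ++ t)) (diffs≡map-pairDiff-steps (xs ∷ʳ u)) (diffs≡map-pairDiff-steps (v ∷ ys))) ⟩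
    absDiff u v ∷ (diffs (xs ∷ʳ u) ++ diffs (v ∷ ys)) ∎
  where open PermutationReasoning

∈-steps⇒middle : ∀ {u v} xs → (u , v) ∈ steps xs → ∃₂ λ ys zs → xs ≡ ys ++ u ∷ v ∷ zs
∈-steps⇒middle (x ∷ y ∷ xs) (here refl) = [] , xs , refl
∈-steps⇒middle (x ∷ y ∷ xs) (there p) with ∈-steps⇒middle (y ∷ xs) p
... | ys , zs , eq = x ∷ ys , zs , cong (x ∷_) eq

middle⇒∈-steps : ∀ xs u v ys → (u , v) ∈ steps (xs ++ u ∷ v ∷ ys)
middle⇒∈-steps []            u v ys = here refl
middle⇒∈-steps (x ∷ [])      u v ys = there (here refl)
middle⇒∈-steps (x ∷ x′ ∷ xs) u v ys = there (middle⇒∈-steps (x′ ∷ xs) u v ys)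

∈-steps-++ˡ : ∀ {p} xs ys → p ∈ steps xs → p ∈ steps (xs ++ ys)
∈-steps-++ˡ (x ∷ y ∷ xs) ys (here refl) = here refl
∈-steps-++ˡ (x ∷ y ∷ xs) ys (there p)   = there (∈-steps-++ˡ (y ∷ xs) ys p)

∈-steps-++ʳ : ∀ {p} xs ys → p ∈ steps ys → p ∈ steps (xs ++ ys)
∈-steps-++ʳ []            ys p = p
∈-steps-++ʳ (x ∷ [])      (y ∷ ys) p = there p
∈-steps-++ʳ (x ∷ x′ ∷ xs) ys p = there (∈-steps-++ʳ (x′ ∷ xs) ys p)

-- Step lists up to orientation of each step

Symmetric : (ℕ → ℕ → ℕ) → Set
Symmetric f = ∀ u w → f u w ≡ f w u

-- S ≈ T: S and T agree as multisets of unordered pairs.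
infix 4 _≈_
_≈_ : List (ℕ × ℕ) → List (ℕ × ℕ) → Set
S ≈ T = ∀ f → Symmetric f → map (uncurry f) S ↭ map (uncurry f) T

≈-refl : ∀ {S} → S ≈ S
≈-refl f _ = ↭-refl

≈-trans : ∀ {S T U} → S ≈ T → T ≈ U → S ≈ U
≈-trans p q f s = ↭-trans (p f s) (q f s)

↭⇒≈ : ∀ {S T} → S ↭ T → S ≈ T
↭⇒≈ p f s = ↭.map⁺ (uncurry f) p

≡⇒≈ : ∀ {S T} → S ≡ T → S ≈ T
≡⇒≈ refl = ≈-refl

≈-++ : ∀ {S S′ T T′} → S ≈ S′ → T ≈ T′ → S ++ T ≈ S′ ++ T′
≈-++ {S} {S′} {T} {T′} p q f s = begin
    map (uncurry f) (S ++ T)                        ≡⟨ List.map-++ (uncurry f) S T ⟩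
    map (uncurry f) S ++ map (uncurry f) T          ↭⟨ ↭.++⁺ (p f s) (q f s) ⟩
    map (uncurry f) S′ ++ map (uncurry f) T′        ≡⟨ List.map-++ (uncurry f) S′ T′ ⟨
    map (uncurry f) (S′ ++ T′)                      ∎
  where open PermutationReasoning

≈-flip : ∀ u w → (u , w) ∷ [] ≈ (w , u) ∷ []
≈-flip u w f s rewrite s u w = ↭-refl

≈-map : ∀ (g : ℕ → ℕ) {S T} → S ≈ T →
  map (λ p → (g (proj₁ p) , g (proj₂ p))) S ≈ map (λ p → (g (proj₁ p) , g (proj₂ p))) T
≈-map g {S} {T} q f s = begin
    map (uncurry f) (map (λ p → (g (proj₁ p) , g (proj₂ p))) S) ≡⟨ List.map-∘ S ⟨
    map (λ p → f (g (proj₁ p)) (g (proj₂ p))) S                 ↭⟨ q (λ u w → f (g u) (g w)) (λ u w → s (g u) (g w)) ⟩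
    map (λ p → f (g (proj₁ p)) (g (proj₂ p))) T                 ≡⟨ List.map-∘ T ⟩
    map (uncurry f) (map (λ p → (g (proj₁ p) , g (proj₂ p))) T) ∎
  where open PermutationReasoning

steps-reverse : ∀ xs → steps (reverse xs) ≈ steps xs
steps-reverse []           = ≈-refl
steps-reverse (x ∷ [])     = ≈-refl
steps-reverse (x ∷ y ∷ xs) =
  ≈-trans (≡⇒≈ unfold)
  (≈-trans (≈-++ (steps-reverse (y ∷ xs)) (≈-flip y x))
           (↭⇒≈ (↭-sym (↭.∷↭∷ʳ (x , y) (steps (y ∷ xs))))))
  where
  unfold : steps (reverse (x ∷ y ∷ xs)) ≡ steps (reverse (y ∷ xs)) ++ (y , x) ∷ []
  unfold = begin
      steps (reverse (x ∷ y ∷ xs))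
        ≡⟨ cong steps (List.unfold-reverse x (y ∷ xs)) ⟩
      steps (reverse (y ∷ xs) ++ x ∷ [])
        ≡⟨ steps-++ (reverse (y ∷ xs)) x [] (subst NonEmpty (sym (List.unfold-reverse y xs)) (NonEmpty-∷ʳ (reverse xs) y)) ⟩
      steps (reverse (y ∷ xs)) ++ (lastD (reverse (y ∷ xs)) , x) ∷ []
        ≡⟨ cong (λ t → steps (reverse (y ∷ xs)) ++ (t , x) ∷ []) (lastD-reverse (y ∷ xs)) ⟩
      steps (reverse (y ∷ xs)) ++ (y , x) ∷ [] ∎
    where open ≡-Reasoning

diffs-≈ : ∀ xs S → steps xs ≈ S → diffs xs ↭ map pairDiff S
diffs-≈ xs S p = subst (_↭ map pairDiff S) (sym (diffs≡map-pairDiff-steps xs)) (p absDiff absDiff-comm)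

map-constant : ∀ {A : Set} (f : A → ℕ) {k} xs → All (λ x → f x ≡ k) xs → map f xs ≡ replicate (length xs) k
map-constant f []       []         = refl
map-constant f (x ∷ xs) (fx ∷ fxs) = cong₂ _∷_ fx (map-constant f xs fxs)

range : ℕ → ℕ → List ℕ
range s zero    = []
range s (suc n) = s ∷ range (suc s) n

rangeDown : ℕ → ℕ → List ℕ
rangeDown s zero    = []
rangeDown s (suc n) = (s + n) ∷ rangeDown s n

length-range : ∀ s n → length (range s n) ≡ n
length-range s zero    = refl
length-range s (suc n) = cong suc (length-range (suc s) n)

upTo≡range : ∀ n → upTo n ≡ range 0 n
upTo≡range n = applyUpTo≡range n (λ i → i) 0 (λ i → refl)
  where
  applyUpTo≡range : ∀ n (f : ℕ → ℕ) s → (∀ i → f i ≡ s + i) → applyUpTo f n ≡ range s n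
  applyUpTo≡range zero    f s h = refl
  applyUpTo≡range (suc n) f s h = cong₂ _∷_ (trans (h 0) (ℕ.+-identityʳ s))
    (applyUpTo≡range n (f ∘ suc) (suc s) (λ i → trans (h (suc i)) (ℕ.+-suc s i)))

range-++ : ∀ s a b → range s (a + b) ≡ range s a ++ range (s + a) b
range-++ s zero    b = cong (λ t → range t b) (sym (ℕ.+-identityʳ s))
range-++ s (suc a) b = cong (s ∷_) (trans (range-++ (suc s) a b) (cong (λ t → range (suc s) a ++ range t b) (sym (ℕ.+-suc s a))))

range-∷ʳ : ∀ s n → range s (suc n) ≡ range s n ∷ʳ (s + n)
range-∷ʳ s n = trans (cong (range s) (ℕ.+-comm 1 n)) (range-++ s n 1)

map-+-range : ∀ k s n → map (k +_) (range s n) ≡ range (k + s) n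
map-+-range k s zero    = refl
map-+-range k s (suc n) = cong ((k + s) ∷_) (trans (map-+-range k (suc s) n) (cong (λ t → range t n) (ℕ.+-suc k s)))

All-range : ∀ {P : ℕ → Set} s n → (∀ c → s ≤ c → c < s + n → P c) → All P (range s n)
All-range s zero    h = []
All-range s (suc n) h =
  h s ℕ.≤-refl (subst (s <_) (sym (ℕ.+-suc s n)) (ℕ.m≤m+n (suc s) n)) ∷
  All-range (suc s) n (λ c p q → h c (ℕ.≤-trans (ℕ.n≤1+n s) p) (subst (c <_) (sym (ℕ.+-suc s n)) q))

All-rangeDown : ∀ {P : ℕ → Set} s n → (∀ c → s ≤ c → c < s + n → P c) → All P (rangeDown s n)
All-rangeDown s zero    h = []
All-rangeDown s (suc n) h =
  h (s + n) (ℕ.m≤m+n s n) (ℕ.+-monoʳ-< s (ℕ.n<1+n n)) ∷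
  All-rangeDown s n (λ c p q → h c p (ℕ.<-trans q (ℕ.+-monoʳ-< s (ℕ.n<1+n n))))

rangeDown-++ : ∀ s a b → rangeDown s (a + b) ≡ rangeDown (s + b) a ++ rangeDown s b
rangeDown-++ s zero    b = refl
rangeDown-++ s (suc a) b = cong₂ _∷_ eq (rangeDown-++ s a b)
  where
  eq : s + (a + b) ≡ (s + b) + a
  eq = trans (cong (s +_) (ℕ.+-comm a b)) (sym (ℕ.+-assoc s b a))

rangeDown↭range : ∀ s n → rangeDown s n ↭ range s n
rangeDown↭range s zero    = ↭-refl
rangeDown↭range s (suc n) = ↭-trans (prep (s + n) (rangeDown↭range s n))
  (↭-trans (↭.∷↭∷ʳ (s + n) (range s n)) (↭-reflexive (sym (range-∷ʳ s n))))

∈-range : ∀ s n {c} → s ≤ c → c < s + n → c ∈ range s n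
∈-range s zero    s≤c c<s+0 = ⊥-elim (ℕ.<-irrefl refl (ℕ.≤-<-trans s≤c (subst (_ <_) (ℕ.+-identityʳ s) c<s+0)))
∈-range s (suc n) {c} s≤c c<s+n with s ℕ.≟ c
... | yes refl = here refl
... | no  s≢c  = there (∈-range (suc s) n (ℕ.≤∧≢⇒< s≤c s≢c) (subst (c <_) (ℕ.+-suc s n) c<s+n))

rangeDown-∷ʳ : ∀ s n → rangeDown s (suc n) ≡ rangeDown (suc s) n ∷ʳ s
rangeDown-∷ʳ s n = trans (cong (rangeDown s) (ℕ.+-comm 1 n))
  (trans (rangeDown-++ s n 1) (cong₂ (λ a b → rangeDown a n ++ [ b ]) (ℕ.+-comm s 1) (ℕ.+-identityʳ s)))

replicate-+ : ∀ {A : Set} a b (x : A) → replicate a x ++ replicate b x ≡ replicate (a + b) x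
replicate-+ zero    b x = refl
replicate-+ (suc a) b x = cong (x ∷_) (replicate-+ a b x)

L1xx1-++ : ∀ m a₁ b₁ c₁ a₂ b₂ c₂ →
  L1xx1 m a₁ b₁ c₁ ++ L1xx1 m a₂ b₂ c₂ ↭ L1xx1 m (a₁ + a₂) (b₁ + b₂) (c₁ + c₂)
L1xx1-++ m a₁ b₁ c₁ a₂ b₂ c₂ = begin
    (A₁ ++ B₁ ++ C₁) ++ (A₂ ++ B₂ ++ C₂)   ≡⟨ List.++-assoc A₁ (B₁ ++ C₁) _ ⟩
    A₁ ++ (B₁ ++ C₁) ++ (A₂ ++ B₂ ++ C₂)   ↭⟨ ↭.++⁺ˡ A₁ (↭.shifts (B₁ ++ C₁) A₂) ⟩
    A₁ ++ A₂ ++ (B₁ ++ C₁) ++ (B₂ ++ C₂)   ≡⟨ cong (λ t → A₁ ++ A₂ ++ t) (List.++-assoc B₁ C₁ _) ⟩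
    A₁ ++ A₂ ++ B₁ ++ C₁ ++ B₂ ++ C₂       ↭⟨ ↭.++⁺ˡ A₁ (↭.++⁺ˡ A₂ (↭.++⁺ˡ B₁ (↭.shifts C₁ B₂))) ⟩
    A₁ ++ A₂ ++ B₁ ++ B₂ ++ C₁ ++ C₂       ≡⟨ sym (List.++-assoc A₁ A₂ _) ⟩
    (A₁ ++ A₂) ++ B₁ ++ B₂ ++ C₁ ++ C₂     ≡⟨ cong₂ _++_ (replicate-+ a₁ a₂ 1) (sym (List.++-assoc B₁ B₂ (C₁ ++ C₂))) ⟩
    A ++ (B₁ ++ B₂) ++ C₁ ++ C₂           ≡⟨ cong₂ (λ s t → A ++ s ++ t) (replicate-+ b₁ b₂ m) (replicate-+ c₁ c₂ (suc m)) ⟩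
    L1xx1 m (a₁ + a₂) (b₁ + b₂) (c₁ + c₂) ∎
  where
  open PermutationReasoning
  A₁ B₁ C₁ A₂ B₂ C₂ A : List ℕ
  A₁ = replicate a₁ 1
  B₁ = replicate b₁ m
  C₁ = replicate c₁ (suc m)
  A₂ = replicate a₂ 1
  B₂ = replicate b₂ m
  C₂ = replicate c₂ (suc m)
  A = replicate (a₁ + a₂) 1

record Realization (m a b c : ℕ) : Set where
  constructor realization
  field
    path       : List ℕ
    isNonEmpty : NonEmpty path
    starts0    : headD path ≡ 0
    visits     : path ↭ range 0 (suc (a + b + c))
    diffs↭     : diffs path ↭ L1xx1 m a b c

-- Perfect realizations end at their maximum, so that another realization can be appended to them.
PerfectRealization : ℕ → ℕ → ℕ → ℕ → Set
PerfectRealization m a b c = Σ (Realization m a b c) λ r → lastD (Realization.path r) ≡ a + b + c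

toStandard : ∀ {x a b c} → Realization x a b c → Σ (List ℕ) (StandardLinearRealization (L1xx1 x a b c))
toStandard {x} {a} {b} {c} (realization (_ ∷ xs) _ refl visits diffs↭) =
  0 ∷ xs , (↭-trans visits (↭-reflexive (sym (trans (cong (upTo ∘ suc) length-L) (upTo≡range _)))) , diffs↭) , refl
  where
  length-L : length (L1xx1 x a b c) ≡ a + b + c
  length-L = begin
      length (replicate a 1 ++ replicate b x ++ replicate c (suc x))
        ≡⟨ List.length-++ (replicate a 1) ⟩
      length (replicate a 1) + length (replicate b x ++ replicate c (suc x))
        ≡⟨ cong₂ _+_ (List.length-replicate a) (trans (List.length-++ (replicate b x)) (cong₂ _+_ (List.length-replicate b) (List.length-replicate c))) ⟩
      a + (b + c)
        ≡⟨ ℕ.+-assoc a b c ⟨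
      a + b + c ∎
    where open ≡-Reasoning

cong₃ : ∀ {A B C D : Set} (f : A → B → C → D) {a a′ b b′ c c′} → a ≡ a′ → b ≡ b′ → c ≡ c′ → f a b c ≡ f a′ b′ c′
cong₃ f refl refl refl = refl

-- Keeps the path definitionally unchanged.
realization-cast : ∀ {m a b c a′ b′ c′} → a ≡ a′ → b ≡ b′ → c ≡ c′ → Realization m a b c → Realization m a′ b′ c′
realization-cast {m} ea eb ec (realization path ne start visits diffs↭) =
  realization path ne start
    (subst (λ k → path ↭ range 0 (suc k)) (cong₃ (λ a b c → a + b + c) ea eb ec) visits)
    (subst (diffs path ↭_) (cong₃ (L1xx1 m) ea eb ec) diffs↭)

diffs-shift : ∀ k xs → diffs (map (k +_) xs) ≡ diffs xs
diffs-shift k []           = refl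
diffs-shift k (x ∷ [])     = refl
diffs-shift k (x ∷ y ∷ xs) = cong₂ _∷_ (absDiff-+-cancelˡ k x y) (diffs-shift k (y ∷ xs))

diffs-glue : ∀ xs z ys → NonEmpty xs → lastD xs ≡ z → diffs (xs ++ ys) ≡ diffs xs ++ diffs (z ∷ ys)
diffs-glue (x ∷ [])      z []       _ _  = refl
diffs-glue (x ∷ [])      z (y ∷ ys) _ eq = cong (λ t → absDiff t y ∷ diffs (y ∷ ys)) eq
diffs-glue (x ∷ x′ ∷ xs) z ys       _ eq = cong (absDiff x x′ ∷_) (diffs-glue (x′ ∷ xs) z ys (nonEmpty x′ xs) eq)

glue : ∀ {m a₁ b₁ c₁ a₂ b₂ c₂} → PerfectRealization m a₁ b₁ c₁ → Realization m a₂ b₂ c₂ →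
  Realization m (a₁ + a₂) (b₁ + b₂) (c₁ + c₂)
glue {m} {a₁} {b₁} {c₁} {a₂} {b₂} {c₂} (realization P neP startP visitsP diffsP , lastP) (realization (_ ∷ R) _ refl visitsR diffsR) =
  realization (P ++ map (n₁ +_) R) (NonEmpty-++ P _ neP) (trans (headD-++ P _ neP) startP) visits diffs↭
  where
  n₁ n₂ : ℕ
  n₁ = a₁ + b₁ + c₁
  n₂ = a₂ + b₂ + c₂
  total : ∀ a₁ b₁ c₁ a₂ b₂ c₂ → suc (a₁ + b₁ + c₁) + (a₂ + b₂ + c₂) ≡ suc ((a₁ + a₂) + (b₁ + b₂) + (c₁ + c₂))
  total = solve-∀
  visits : P ++ map (n₁ +_) R ↭ range 0 (suc ((a₁ + a₂) + (b₁ + b₂) + (c₁ + c₂)))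
  visits = begin
      P ++ map (n₁ +_) R                        ↭⟨ ↭.++⁺ visitsP (↭.map⁺ (n₁ +_) (↭.drop-∷ visitsR)) ⟩
      range 0 (suc n₁) ++ map (n₁ +_) (range 1 n₂) ≡⟨ cong (range 0 (suc n₁) ++_) (trans (map-+-range n₁ 1 n₂) (cong (λ t → range t n₂) (ℕ.+-comm n₁ 1))) ⟩
      range 0 (suc n₁) ++ range (suc n₁) n₂      ≡⟨ range-++ 0 (suc n₁) n₂ ⟨
      range 0 (suc n₁ + n₂)                      ≡⟨ cong (range 0) (total a₁ b₁ c₁ a₂ b₂ c₂) ⟩
      range 0 (suc ((a₁ + a₂) + (b₁ + b₂) + (c₁ + c₂))) ∎
    where open PermutationReasoning
  diffs↭ : diffs (P ++ map (n₁ +_) R) ↭ L1xx1 m (a₁ + a₂) (b₁ + b₂) (c₁ + c₂)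
  diffs↭ = begin
      diffs (P ++ map (n₁ +_) R)               ≡⟨ diffs-glue P n₁ (map (n₁ +_) R) neP lastP ⟩
      diffs P ++ diffs (n₁ ∷ map (n₁ +_) R)     ≡⟨ cong (λ t → diffs P ++ diffs (t ∷ map (n₁ +_) R)) (sym (ℕ.+-identityʳ n₁)) ⟩
      diffs P ++ diffs (map (n₁ +_) (0 ∷ R))    ≡⟨ cong (diffs P ++_) (diffs-shift n₁ (0 ∷ R)) ⟩
      diffs P ++ diffs (0 ∷ R)                  ↭⟨ ↭.++⁺ diffsP diffsR ⟩
      L1xx1 m a₁ b₁ c₁ ++ L1xx1 m a₂ b₂ c₂      ↭⟨ L1xx1-++ m a₁ b₁ c₁ a₂ b₂ c₂ ⟩
      L1xx1 m (a₁ + a₂) (b₁ + b₂) (c₁ + c₂)     ∎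
    where open PermutationReasoning

-- Elementary perfect realizations

perfectOnes : ∀ m k → PerfectRealization m k 0 0
perfectOnes m k = realization (range 0 (suc k)) (nonEmpty 0 _) refl
    (↭-reflexive (cong (λ t → range 0 (suc t)) (sym k+0+0)))
    (↭-reflexive (trans (diffs-range 0 k) (sym (List.++-identityʳ (replicate k 1)))))
  , trans (lastD-range 0 k) (sym k+0+0)
  where
  k+0+0 : k + 0 + 0 ≡ k
  k+0+0 = trans (ℕ.+-identityʳ (k + 0)) (ℕ.+-identityʳ k)
  diffs-range : ∀ s k → diffs (range s (suc k)) ≡ replicate k 1
  diffs-range s zero    = refl
  diffs-range s (suc k) = cong₂ _∷_ (absDiff-suc s) (diffs-range (suc s) k)
  lastD-range : ∀ s k → lastD (range s (suc k)) ≡ s + k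
  lastD-range s zero    = sym (ℕ.+-identityʳ s)
  lastD-range s (suc k) = trans (lastD-range (suc s) k) (sym (ℕ.+-suc s k))

padOnes : ∀ {m a′ b c} a → a′ ≤ a → Realization m a′ b c → Realization m a b c
padOnes {a′ = a′} a a′≤a r = realization-cast (ℕ.m∸n+n≡m a′≤a) refl refl (glue (perfectOnes _ (a ∸ a′)) r)

zigzag : ℕ → ℕ → ℕ → List ℕ
zigzag x s zero    = []
zigzag x s (suc n) = s ∷ (suc x + s) ∷ zigzag x (suc s) n

zigzag-↭ : ∀ x s n → zigzag x s n ↭ range s n ++ range (suc x + s) n
zigzag-↭ x s zero    = ↭-refl
zigzag-↭ x s (suc n) = prep s (↭-trans
  (prep (suc x + s) (↭-trans (zigzag-↭ x (suc s) n) (↭-reflexive (cong (λ t → range (suc s) n ++ range t n) (ℕ.+-suc (suc x) s)))))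
  (↭-sym (↭.shift (suc x + s) (range (suc s) n) (range (suc (suc x + s)) n))))

diffs-zigzag : ∀ x s n → diffs (zigzag x s (suc n)) ↭ replicate n x ++ replicate (suc n) (suc x)
diffs-zigzag x s zero    = ↭-reflexive (cong [_] (absDiff-+ʳ s (suc x)))
diffs-zigzag x s (suc n) = begin
    absDiff s (suc x + s) ∷ absDiff (suc x + s) (suc s) ∷ diffs (zigzag x (suc s) (suc n))
      ≡⟨ cong₂ (λ u v → u ∷ v ∷ diffs (zigzag x (suc s) (suc n))) (absDiff-+ʳ s (suc x)) (absDiff-+ˡ s x) ⟩
    suc x ∷ x ∷ diffs (zigzag x (suc s) (suc n))
      ↭⟨ swap (suc x) x (diffs-zigzag x (suc s) n) ⟩
    x ∷ suc x ∷ (replicate n x ++ replicate (suc n) (suc x))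
      ↭⟨ prep x (↭-sym (↭.shift (suc x) (replicate n x) (replicate (suc n) (suc x)))) ⟩
    x ∷ (replicate n x ++ suc x ∷ replicate (suc n) (suc x)) ∎
  where open PermutationReasoning

lastD-zigzag : ∀ x s n → lastD (zigzag x s (suc n)) ≡ suc x + (s + n)
lastD-zigzag x s zero    = cong (suc x +_) (sym (ℕ.+-identityʳ s))
lastD-zigzag x s (suc n) = trans (lastD-zigzag x (suc s) n) (cong (suc x +_) (sym (ℕ.+-suc s n)))

perfectZigzag : ∀ x → PerfectRealization x 0 x (suc x)
perfectZigzag x = realization (zigzag x 0 (suc x)) (nonEmpty 0 _) refl visits (diffs-zigzag x 0 x)
                , trans (lastD-zigzag x 0 x) (e₂ x)
  where
  e₁ : ∀ x → suc x + suc x ≡ suc (0 + x + suc x)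
  e₁ = solve-∀
  e₂ : ∀ x → suc x + (0 + x) ≡ 0 + x + suc x
  e₂ = solve-∀
  visits : zigzag x 0 (suc x) ↭ range 0 (suc (0 + x + suc x))
  visits = begin
      zigzag x 0 (suc x)                             ↭⟨ zigzag-↭ x 0 (suc x) ⟩
      range 0 (suc x) ++ range (suc x + 0) (suc x)   ≡⟨ cong (λ t → range 0 (suc x) ++ range t (suc x)) (ℕ.+-identityʳ (suc x)) ⟩
      range 0 (suc x) ++ range (suc x) (suc x)       ≡⟨ range-++ 0 (suc x) (suc x) ⟨
      range 0 (suc x + suc x)                        ≡⟨ cong (range 0) (e₁ x) ⟩
      range 0 (suc (0 + x + suc x))                  ∎
    where open PermutationReasoning

perfectZigzagTail : ∀ x₂ → PerfectRealization (suc (suc x₂)) 1 (suc (suc x₂)) (suc x₂)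
perfectZigzagTail x₂ = realization L (nonEmpty 0 _) refl visits diffs↭ , lastL
  where
  x : ℕ
  x = suc (suc x₂)
  Z tl L : List ℕ
  Z  = zigzag x 0 (suc x₂)
  tl = suc x₂ ∷ x ∷ (x + x) ∷ []
  L  = Z ++ tl
  e₁ : ∀ x₂ → suc (suc (suc x₂)) + suc x₂ ≡ suc (suc x₂) + suc (suc x₂)
  e₁ = solve-∀
  e₂ : ∀ x₂ → suc x₂ + suc (suc (suc (suc x₂))) ≡ suc (1 + suc (suc x₂) + suc x₂)
  e₂ = solve-∀
  e₃ : ∀ x₂ → suc (suc x₂) + suc (suc x₂) ≡ 1 + suc (suc x₂) + suc x₂
  e₃ = solve-∀
  visits : L ↭ range 0 (suc (1 + x + suc x₂))
  visits = begin
      Z ++ tl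
        ↭⟨ ↭.++⁺ʳ tl (↭-trans (zigzag-↭ x 0 (suc x₂)) (↭-reflexive (cong (λ t → range 0 (suc x₂) ++ range t (suc x₂)) (ℕ.+-identityʳ (suc x))))) ⟩
      (range 0 (suc x₂) ++ range (suc x) (suc x₂)) ++ tl
        ≡⟨ List.++-assoc (range 0 (suc x₂)) _ _ ⟩
      range 0 (suc x₂) ++ range (suc x) (suc x₂) ++ suc x₂ ∷ x ∷ (x + x) ∷ []
        ↭⟨ ↭.++⁺ˡ (range 0 (suc x₂)) (↭.shifts (range (suc x) (suc x₂)) (suc x₂ ∷ x ∷ [])) ⟩
      range 0 (suc x₂) ++ suc x₂ ∷ x ∷ range (suc x) (suc x₂) ++ (x + x) ∷ []
        ≡⟨ cong (λ z → range 0 (suc x₂) ++ suc x₂ ∷ x ∷ z) (sym (trans (range-∷ʳ (suc x) (suc x₂)) (cong (λ t → range (suc x) (suc x₂) ∷ʳ t) (e₁ x₂)))) ⟩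
      range 0 (suc x₂) ++ range (suc x₂) (suc (suc (suc (suc x₂))))
        ≡⟨ range-++ 0 (suc x₂) (suc (suc (suc (suc x₂)))) ⟨
      range 0 (suc x₂ + suc (suc (suc (suc x₂))))
        ≡⟨ cong (range 0) (e₂ x₂) ⟩
      range 0 (suc (1 + x + suc x₂)) ∎
    where open PermutationReasoning
  diffs↭ : diffs L ↭ L1xx1 x 1 x (suc x₂)
  diffs↭ = begin
      diffs (Z ++ tl)
        ≡⟨ diffs-glue Z (suc x + x₂) tl (nonEmpty 0 _) (lastD-zigzag x 0 x₂) ⟩
      diffs Z ++ absDiff (suc x + x₂) (suc x₂) ∷ absDiff (suc x₂) x ∷ absDiff x (x + x) ∷ []
        ≡⟨ cong (diffs Z ++_) (cong₂ _∷_ (absDiff-+ˡ x₂ x) (cong₂ (λ u v → u ∷ v ∷ []) (absDiff-suc (suc x₂)) (absDiff-+ʳ x x))) ⟩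
      diffs Z ++ x ∷ 1 ∷ x ∷ []
        ↭⟨ ↭.++⁺ʳ _ (diffs-zigzag x 0 x₂) ⟩
      (replicate x₂ x ++ replicate (suc x₂) (suc x)) ++ x ∷ 1 ∷ x ∷ []
        ↭⟨ ↭.++-comm (replicate x₂ x ++ replicate (suc x₂) (suc x)) (x ∷ 1 ∷ x ∷ []) ⟩
      x ∷ 1 ∷ x ∷ (replicate x₂ x ++ replicate (suc x₂) (suc x))
        ↭⟨ swap x 1 ↭-refl ⟩
      1 ∷ x ∷ x ∷ (replicate x₂ x ++ replicate (suc x₂) (suc x))
        ↭⟨ prep 1 (prep x (↭-sym (↭.shift x (replicate x₂ x) (replicate (suc x₂) (suc x))))) ⟩
      1 ∷ x ∷ (replicate x₂ x ++ x ∷ replicate (suc x₂) (suc x))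
        ≡⟨ cong (λ z → 1 ∷ x ∷ z) (trans (sym (List.++-assoc (replicate x₂ x) [ x ] _))
             (cong (_++ replicate (suc x₂) (suc x)) (trans (replicate-+ x₂ 1 x) (cong (λ t → replicate t x) (ℕ.+-comm x₂ 1))))) ⟩
      L1xx1 x 1 x (suc x₂) ∎
    where open PermutationReasoning
  lastL : lastD L ≡ 1 + x + suc x₂
  lastL = trans (lastD-++ Z tl (nonEmpty (suc x₂) _)) (e₃ x₂)

-- Columns of the grid with m columns, and the snakes through them

column : ℕ → ℕ → ℕ → List ℕ
column m s zero    = []
column m s (suc h) = s ∷ column m (m + s) h

+-exchange : ∀ a b c → a + (b + c) ≡ b + (a + c)
+-exchange a b c = trans (sym (ℕ.+-assoc a b c)) (trans (cong (_+ c) (ℕ.+-comm a b)) (ℕ.+-assoc b a c))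

column-shift : ∀ m k s h → column m (k + s) h ≡ map (k +_) (column m s h)
column-shift m k s zero    = refl
column-shift m k s (suc h) = cong ((k + s) ∷_) (trans (cong (λ t → column m t h) (+-exchange m k s)) (column-shift m k (m + s) h))

column-∷ʳ : ∀ m s h → column m s (suc h) ≡ column m s h ∷ʳ (h * m + s)
column-∷ʳ m s zero    = refl
column-∷ʳ m s (suc h) = cong (s ∷_) (trans (column-∷ʳ m (m + s) h)
  (cong (column m (m + s) h ∷ʳ_) (trans (+-exchange (h * m) m s) (sym (ℕ.+-assoc m (h * m) s)))))

column-last-two : ∀ m s h → column m s (suc (suc h)) ≡ column m s h ++ (h * m + s) ∷ (suc h * m + s) ∷ []
column-last-two m s h = trans (column-∷ʳ m s (suc h))
  (trans (cong (_∷ʳ (suc h * m + s)) (column-∷ʳ m s h)) (List.++-assoc (column m s h) [ h * m + s ] [ suc h * m + s ]))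

lastD-column : ∀ m s h → lastD (column m s (suc h)) ≡ h * m + s
lastD-column m s h = trans (cong lastD (column-∷ʳ m s h)) (lastD-∷ʳ (column m s h) (h * m + s))

vertical : ℕ → ℕ → ℕ × ℕ
vertical m v = (v , m + v)

steps-column : ∀ m s h → steps (column m s (suc h)) ≡ map (vertical m) (column m s h)
steps-column m s zero    = refl
steps-column m s (suc h) = cong ((s , m + s) ∷_) (steps-column m (m + s) h)

<ᵇ-true : ∀ {c R} → c < R → (c <ᵇ R) ≡ true
<ᵇ-true {zero}  {suc R} _       = refl
<ᵇ-true {suc c} {suc R} (s≤s p) = <ᵇ-true {c} {R} p

<ᵇ-false : ∀ {c R} → R ≤ c → (c <ᵇ R) ≡ false
<ᵇ-false {c}     {zero}  _       = refl
<ᵇ-false {suc c} {suc R} (s≤s p) = <ᵇ-false {c} {R} p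

-- The first R columns get one extra row.
extra : ℕ → ℕ → ℕ
extra R c = if c <ᵇ R then 1 else 0

extra-< : ∀ {R c} → c < R → extra R c ≡ 1
extra-< c<R rewrite <ᵇ-true c<R = refl

extra-≥ : ∀ {R c} → R ≤ c → extra R c ≡ 0
extra-≥ R≤c rewrite <ᵇ-false R≤c = refl

extra-suc : ∀ R c → suc c ≢ R → extra R c ≡ extra R (suc c)
extra-suc R c sc≢R with suc c ℕ.<? R
... | yes sc<R = trans (extra-< (ℕ.<-trans (ℕ.n<1+n c) sc<R)) (sym (extra-< sc<R))
... | no  sc≮R = trans (extra-≥ (ℕ.≤-pred (ℕ.≤∧≢⇒< (ℕ.≮⇒≥ sc≮R) (sc≢R ∘ sym)))) (sym (extra-≥ (ℕ.≮⇒≥ sc≮R)))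

heads-out : ∀ {A : Set} (f : A → ℕ) (g : A → List ℕ) xs →
  concat (map (λ c → f c ∷ g c) xs) ↭ map f xs ++ concat (map g xs)
heads-out f g []       = ↭-refl
heads-out f g (x ∷ xs) = prep (f x) (↭-trans (↭.++⁺ˡ (g x) (heads-out f g xs)) (↭.shifts (g x) (map f xs)))

columns-tile : ∀ m K R → R ≤ m → concat (map (λ c → column m c (K + extra R c)) (range 0 m)) ↭ range 0 (K * m + R)
columns-tile m zero R R≤m = ↭-reflexive (begin
    concat (map (λ c → column m c (extra R c)) (range 0 m))
      ≡⟨ cong (concat ∘ map (λ c → column m c (extra R c))) (trans (cong (range 0) (sym (ℕ.m+[n∸m]≡n R≤m))) (range-++ 0 R (m ∸ R))) ⟩
    concat (map (λ c → column m c (extra R c)) (range 0 R ++ range R (m ∸ R)))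
      ≡⟨ cong concat (List.map-++ (λ c → column m c (extra R c)) (range 0 R) (range R (m ∸ R))) ⟩
    concat (map (λ c → column m c (extra R c)) (range 0 R) ++ map (λ c → column m c (extra R c)) (range R (m ∸ R)))
      ≡⟨ List.concat-++ (map (λ c → column m c (extra R c)) (range 0 R)) _ ⟨
    concat (map (λ c → column m c (extra R c)) (range 0 R)) ++ concat (map (λ c → column m c (extra R c)) (range R (m ∸ R)))
      ≡⟨ cong₂ _++_ (trans (cong concat (List.map-cong-local (All-range 0 R (λ c _ c<R → cong (column m c) (extra-< c<R))))) (List.concat-map-[ range 0 R ]))
                    (trans (cong concat (List.map-cong-local (All-range R (m ∸ R) (λ c R≤c _ → cong (column m c) (extra-≥ R≤c))))) (concat-[] (range R (m ∸ R)))) ⟩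
    range 0 R ++ []
      ≡⟨ List.++-identityʳ _ ⟩
    range 0 R ∎)
  where
  open ≡-Reasoning
  concat-[] : ∀ (xs : List ℕ) → concat (map (λ _ → List.[] {A = ℕ}) xs) ≡ []
  concat-[] []       = refl
  concat-[] (_ ∷ xs) = concat-[] xs
columns-tile m (suc K) R R≤m = begin
    concat (map (λ c → c ∷ column m (m + c) (K + extra R c)) (range 0 m))
      ↭⟨ heads-out (λ c → c) (λ c → column m (m + c) (K + extra R c)) (range 0 m) ⟩
    map (λ c → c) (range 0 m) ++ concat (map (λ c → column m (m + c) (K + extra R c)) (range 0 m))
      ≡⟨ cong₂ _++_ (List.map-id (range 0 m)) (cong concat (List.map-cong (λ c → column-shift m m c (K + extra R c)) (range 0 m))) ⟩
    range 0 m ++ concat (map (λ c → map (m +_) (column m c (K + extra R c))) (range 0 m))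
      ≡⟨ cong (range 0 m ++_) (trans (cong concat (List.map-∘ (range 0 m))) (List.concat-map (map (λ c → column m c (K + extra R c)) (range 0 m)))) ⟩
    range 0 m ++ map (m +_) (concat (map (λ c → column m c (K + extra R c)) (range 0 m)))
      ↭⟨ ↭.++⁺ˡ (range 0 m) (↭.map⁺ (m +_) (columns-tile m K R R≤m)) ⟩
    range 0 m ++ map (m +_) (range 0 (K * m + R))
      ≡⟨ cong (range 0 m ++_) (trans (map-+-range m 0 (K * m + R)) (cong (λ t → range t (K * m + R)) (ℕ.+-identityʳ m))) ⟩
    range 0 m ++ range m (K * m + R)
      ≡⟨ range-++ 0 m (K * m + R) ⟨
    range 0 (m + (K * m + R))
      ≡⟨ cong (range 0) (sym (ℕ.+-assoc m (K * m) R)) ⟩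
    range 0 (suc K * m + R) ∎
  where open PermutationReasoning

junctions : List (List ℕ) → List (ℕ × ℕ)
junctions []           = []
junctions (s ∷ [])     = []
junctions (s ∷ t ∷ ss) = (lastD s , headD t) ∷ junctions (t ∷ ss)

length-junctions : ∀ s ss → length (junctions (s ∷ ss)) ≡ length ss
length-junctions s []       = refl
length-junctions s (t ∷ ss) = cong suc (length-junctions t ss)

steps-concat : ∀ segs → All NonEmpty segs → steps (concat segs) ↭ concat (map steps segs) ++ junctions segs
steps-concat []                  _              = ↭-refl
steps-concat (s ∷ [])            _              =
  ↭-reflexive (trans (cong steps (List.++-identityʳ s)) (sym (trans (List.++-identityʳ _) (List.++-identityʳ _))))
steps-concat (s ∷ (y ∷ t) ∷ ss) (nes ∷ net ∷ ness) = begin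
    steps (s ++ y ∷ (t ++ concat ss))
      ≡⟨ steps-++ s y (t ++ concat ss) nes ⟩
    steps s ++ (lastD s , y) ∷ steps (concat ((y ∷ t) ∷ ss))
      ↭⟨ ↭.++⁺ˡ (steps s) (prep _ (steps-concat ((y ∷ t) ∷ ss) (net ∷ ness))) ⟩
    steps s ++ (lastD s , y) ∷ (concat (map steps ((y ∷ t) ∷ ss)) ++ junctions ((y ∷ t) ∷ ss))
      ↭⟨ ↭.++⁺ˡ (steps s) (↭-sym (↭.shift (lastD s , y) (concat (map steps ((y ∷ t) ∷ ss))) _)) ⟩
    steps s ++ (concat (map steps ((y ∷ t) ∷ ss)) ++ (lastD s , y) ∷ junctions ((y ∷ t) ∷ ss))
      ≡⟨ List.++-assoc (steps s) _ _ ⟨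
    (steps s ++ concat (map steps ((y ∷ t) ∷ ss))) ++ (lastD s , y) ∷ junctions ((y ∷ t) ∷ ss) ∎
  where open PermutationReasoning

junctions-range : ∀ (f : ℕ → List ℕ) s n →
  junctions (map f (range s (suc n))) ≡ map (λ c → (lastD (f c) , headD (f (suc c)))) (range s n)
junctions-range f s zero    = refl
junctions-range f s (suc n) = cong ((lastD (f s) , headD (f (suc s))) ∷_) (junctions-range f (suc s) n)

junctions-rangeDown : ∀ (f : ℕ → List ℕ) s n →
  junctions (map f (rangeDown s (suc n))) ≡ map (λ c → (lastD (f (suc c)) , headD (f c))) (rangeDown s n)
junctions-rangeDown f s zero    = refl
junctions-rangeDown f s (suc n) =
  cong₂ _∷_ (cong (λ t → (lastD (f t) , headD (f (s + n)))) (ℕ.+-suc s n)) (junctions-rangeDown f s n)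

concat-map-↭ : ∀ {A B : Set} (f : A → List B) {xs ys} → xs ↭ ys → concat (map f xs) ↭ concat (map f ys)
concat-map-↭ f Perm.refl          = ↭-refl
concat-map-↭ f (Perm.prep x p)    = ↭.++⁺ˡ (f x) (concat-map-↭ f p)
concat-map-↭ f (Perm.swap x y p)  = ↭-trans (↭.shifts (f x) (f y)) (↭.++⁺ˡ (f y) (↭.++⁺ˡ (f x) (concat-map-↭ f p)))
concat-map-↭ f (Perm.trans p q)   = ↭-trans (concat-map-↭ f p) (concat-map-↭ f q)

concat-map-pointwise-↭ : ∀ {A B : Set} (f g : A → List B) xs → (∀ c → f c ↭ g c) → concat (map f xs) ↭ concat (map g xs)
concat-map-pointwise-↭ f g []       h = ↭-refl
concat-map-pointwise-↭ f g (x ∷ xs) h = ↭.++⁺ (h x) (concat-map-pointwise-↭ f g xs h)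

concat-map-≈ : ∀ {A : Set} (F G : A → List (ℕ × ℕ)) xs → (∀ c → F c ≈ G c) → concat (map F xs) ≈ concat (map G xs)
concat-map-≈ F G []       h = ≈-refl
concat-map-≈ F G (x ∷ xs) h = ≈-++ (h x) (concat-map-≈ F G xs h)

orient : Bool → List ℕ → List ℕ
orient true  l = l
orient false l = reverse l

NonEmpty-orient : ∀ d x xs → NonEmpty (orient d (x ∷ xs))
NonEmpty-orient true  x xs = nonEmpty x xs
NonEmpty-orient false x xs = subst NonEmpty (sym (List.unfold-reverse x xs)) (NonEmpty-∷ʳ (reverse xs) x)

orient-↭ : ∀ d l → orient d l ↭ l
orient-↭ true  l = ↭-refl
orient-↭ false l = ↭.↭-reverse l

steps-orient : ∀ d l → steps (orient d l) ≈ steps l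
steps-orient true  l = ≈-refl
steps-orient false l = steps-reverse l

orient-last-two : ∀ d xs u v → (v , u) ∈ steps (orient d (xs ++ u ∷ v ∷ [])) ⊎ (u , v) ∈ steps (orient d (xs ++ u ∷ v ∷ []))
orient-last-two true  xs u v = inj₂ (middle⇒∈-steps xs u v [])
orient-last-two false xs u v = inj₁ (subst (λ ys → (v , u) ∈ steps ys) (sym (List.reverse-++ xs (u ∷ v ∷ []))) (here refl))

punchIn : ℕ → ℕ → ℕ
punchIn j v = if v <ᵇ j then v else suc v

punchIn² : ℕ → ℕ × ℕ → ℕ × ℕ
punchIn² j p = (punchIn j (proj₁ p) , punchIn j (proj₂ p))

punchIn-< : ∀ {j v} → v < j → punchIn j v ≡ v
punchIn-< v<j rewrite <ᵇ-true v<j = refl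

punchIn-≥ : ∀ {j v} → j ≤ v → punchIn j v ≡ suc v
punchIn-≥ j≤v rewrite <ᵇ-false j≤v = refl

splice : ℕ → List ℕ → List ℕ → List ℕ
splice j xs ys = map (punchIn j) xs ++ j ∷ map (punchIn j) ys

insert-↭ : ∀ j n → j ≤ n → j ∷ map (punchIn j) (range 0 n) ↭ range 0 (suc n)
insert-↭ j n j≤n = begin
    j ∷ map (punchIn j) (range 0 n)
      ≡⟨ cong (λ t → j ∷ map (punchIn j) t) (trans (cong (range 0) (sym (ℕ.m+[n∸m]≡n j≤n))) (range-++ 0 j (n ∸ j))) ⟩
    j ∷ map (punchIn j) (range 0 j ++ range j (n ∸ j))
      ≡⟨ cong (j ∷_) (List.map-++ (punchIn j) (range 0 j) (range j (n ∸ j))) ⟩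
    j ∷ (map (punchIn j) (range 0 j) ++ map (punchIn j) (range j (n ∸ j)))
      ≡⟨ cong (j ∷_) (cong₂ _++_ below above) ⟩
    j ∷ (range 0 j ++ range (suc j) (n ∸ j))
      ↭⟨ ↭.shift j (range 0 j) (range (suc j) (n ∸ j)) ⟨
    range 0 j ++ range j (suc (n ∸ j))
      ≡⟨ range-++ 0 j (suc (n ∸ j)) ⟨
    range 0 (j + suc (n ∸ j))
      ≡⟨ cong (range 0) (trans (ℕ.+-suc j (n ∸ j)) (cong suc (ℕ.m+[n∸m]≡n j≤n))) ⟩
    range 0 (suc n) ∎
  where
  open PermutationReasoning
  below : map (punchIn j) (range 0 j) ≡ range 0 j
  below = List.map-id-local (All-range 0 j (λ _ _ c<j → punchIn-< c<j))
  above : map (punchIn j) (range j (n ∸ j)) ≡ range (suc j) (n ∸ j)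
  above = trans (List.map-cong-local (All-range j (n ∸ j) (λ _ j≤c _ → punchIn-≥ j≤c))) (map-+-range 1 j (n ∸ j))

splice-↭ : ∀ j xs ys N → xs ++ ys ↭ range 0 (suc N) → j ≤ N → splice j xs ys ↭ range 0 (suc (suc N))
splice-↭ j xs ys N p j≤N = begin
    map (punchIn j) xs ++ j ∷ map (punchIn j) ys   ↭⟨ ↭.shift j (map (punchIn j) xs) (map (punchIn j) ys) ⟩
    j ∷ (map (punchIn j) xs ++ map (punchIn j) ys) ≡⟨ cong (j ∷_) (List.map-++ (punchIn j) xs ys) ⟨
    j ∷ map (punchIn j) (xs ++ ys)                 ↭⟨ prep j (↭.map⁺ (punchIn j) p) ⟩
    j ∷ map (punchIn j) (range 0 (suc N))          ↭⟨ insert-↭ j (suc N) (ℕ.≤-trans j≤N (ℕ.n≤1+n N)) ⟩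
    range 0 (suc (suc N))                          ∎
  where open PermutationReasoning

steps-splice : ∀ j xs ys → NonEmpty xs → NonEmpty ys →
  steps (splice j xs ys) ≡ map (punchIn² j) (steps xs) ++ (punchIn j (lastD xs) , j) ∷ (j , punchIn j (headD ys)) ∷ map (punchIn² j) (steps ys)
steps-splice j xs (y ∷ ys) nexs _ = begin
    steps (map (punchIn j) xs ++ j ∷ map (punchIn j) (y ∷ ys))
      ≡⟨ steps-++ (map (punchIn j) xs) j _ (NonEmpty-map (punchIn j) xs nexs) ⟩
    steps (map (punchIn j) xs) ++ (lastD (map (punchIn j) xs) , j) ∷ (j , punchIn j y) ∷ steps (map (punchIn j) (y ∷ ys))
      ≡⟨ cong₃ (λ s t u → s ++ (t , j) ∷ (j , punchIn j y) ∷ u) (steps-map (punchIn j) xs) (lastD-map (punchIn j) xs nexs) (steps-map (punchIn j) (y ∷ ys)) ⟩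
    map (punchIn² j) (steps xs) ++ (punchIn j (lastD xs) , j) ∷ (j , punchIn j y) ∷ map (punchIn² j) (steps (y ∷ ys)) ∎
  where open ≡-Reasoning

∈-steps-splice : ∀ {p} j xs ys → NonEmpty xs → NonEmpty ys → p ∈ steps xs ⊎ p ∈ steps ys → punchIn² j p ∈ steps (splice j xs ys)
∈-steps-splice {p} j xs ys nexs neys p∈ = subst (punchIn² j p ∈_) (sym (steps-splice j xs ys nexs neys)) (located p∈)
  where
  located : p ∈ steps xs ⊎ p ∈ steps ys →
       punchIn² j p ∈ map (punchIn² j) (steps xs) ++ (punchIn j (lastD xs) , j) ∷ (j , punchIn j (headD ys)) ∷ map (punchIn² j) (steps ys)
  located (inj₁ p∈xs) = ∈.∈-++⁺ˡ (∈.∈-map⁺ (punchIn² j) p∈xs)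
  located (inj₂ p∈ys) = ∈.∈-++⁺ʳ (map (punchIn² j) (steps xs)) (there (there (∈.∈-map⁺ (punchIn² j) p∈ys)))

-- A step p = {u, u+1} "joins" column c to column c+1 if u lies in column c: either u = c or u is
-- beyond the first row.  Splicing at j ≤ m then keeps p a unit step unless c + 1 = j.
data Joins (m c : ℕ) : ℕ × ℕ → Set where
  rise : ∀ u → u ≡ c ⊎ m ≤ u → Joins m c (u , suc u)
  fall : ∀ u → u ≡ c ⊎ m ≤ u → Joins m c (suc u , u)

pairDiff-Joins : ∀ {m c p} → Joins m c p → pairDiff p ≡ 1
pairDiff-Joins (rise u _) = absDiff-suc u
pairDiff-Joins (fall u _) = absDiff-sucˡ u

absDiff-punchIn-suc : ∀ j u → suc u ≢ j → absDiff (punchIn j u) (punchIn j (suc u)) ≡ 1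
absDiff-punchIn-suc j u su≢j with suc u ℕ.<? j
... | yes su<j = trans (cong₂ absDiff (punchIn-< (ℕ.<-trans (ℕ.n<1+n u) su<j)) (punchIn-< su<j)) (absDiff-suc u)
... | no  su≮j = trans (cong₂ absDiff (punchIn-≥ j≤u) (punchIn-≥ (ℕ.≤-trans j≤u (ℕ.n≤1+n u)))) (absDiff-suc (suc u))
  where
  j≤u : j ≤ u
  j≤u = ℕ.≤-pred (ℕ.≤∧≢⇒< (ℕ.≮⇒≥ su≮j) (su≢j ∘ sym))

pairDiff-punchIn-Joins : ∀ {m c p} j → j ≤ m → suc c ≢ j → Joins m c p → pairDiff (punchIn² j p) ≡ 1
pairDiff-punchIn-Joins j j≤m sc≢j (rise u u∈c) = absDiff-punchIn-suc j u (suc≢ j≤m sc≢j u∈c)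
  where
  suc≢ : ∀ {m c u j} → j ≤ m → suc c ≢ j → u ≡ c ⊎ m ≤ u → suc u ≢ j
  suc≢ _   sc≢j (inj₁ refl) = sc≢j
  suc≢ j≤m _    (inj₂ m≤u)  = ℕ.<⇒≢ (s≤s (ℕ.≤-trans j≤m m≤u)) ∘ sym
pairDiff-punchIn-Joins j j≤m sc≢j (fall u u∈c) =
  trans (absDiff-comm (punchIn j (suc u)) (punchIn j u)) (pairDiff-punchIn-Joins j j≤m sc≢j (rise u u∈c))

punchIn²-≥ : ∀ {j u v} → j ≤ u → j ≤ v → punchIn² j (u , v) ≡ (suc u , suc v)
punchIn²-≥ j≤u j≤v = cong₂ _,_ (punchIn-≥ j≤u) (punchIn-≥ j≤v)

-- Extending a realization at its maximum M: inserting M + 1 between neighbours at distance m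

NonEmpty-middle : ∀ xs u ys → NonEmpty (xs ++ u ∷ ys)
NonEmpty-middle []       u ys = nonEmpty u ys
NonEmpty-middle (x ∷ xs) u ys = nonEmpty x _

↭-insert-max : ∀ xs ys k → xs ++ ys ↭ range 0 k → xs ++ k ∷ ys ↭ range 0 (suc k)
↭-insert-max xs ys k p = begin
    xs ++ k ∷ ys     ↭⟨ ↭.shift k xs ys ⟩
    k ∷ (xs ++ ys)   ↭⟨ prep k p ⟩
    k ∷ range 0 k    ↭⟨ ↭.∷↭∷ʳ k (range 0 k) ⟩
    range 0 k ∷ʳ k   ≡⟨ range-∷ʳ 0 k ⟨
    range 0 (suc k)  ∎
  where open PermutationReasoning

diffs-insert : ∀ xs u z v ys → diffs (xs ++ u ∷ z ∷ v ∷ ys) ↭ absDiff u z ∷ absDiff z v ∷ (diffs (xs ∷ʳ u) ++ diffs (v ∷ ys))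
diffs-insert xs u z v ys = ↭-trans (diffs-middle xs u z (v ∷ ys)) (prep (absDiff u z) (↭.shift (absDiff z v) (diffs (xs ∷ʳ u)) (diffs (v ∷ ys))))

insertMax : ∀ {m a b c} (r : Realization m a (suc b) c) xs u v ys → Realization.path r ≡ xs ++ u ∷ v ∷ ys →
  absDiff u v ≡ m →
  absDiff u (suc (a + suc b + c)) ∷ absDiff (suc (a + suc b + c)) v ∷ [] ↭ 1 ∷ suc m ∷ [] →
  Realization m (suc a) b (suc c)
insertMax {m} {a} {b} {c} (realization _ _ start visits diffs↭) xs u v ys refl uv≡m around =
  realization path (NonEmpty-middle xs u _) (trans (headD-middle xs u _ _) start) visits′ diffs′
  where
  M : ℕ
  M = a + suc b + c
  path : List ℕ
  path = xs ++ u ∷ suc M ∷ v ∷ ys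
  total : ∀ a b c → suc (suc (a + suc b + c)) ≡ suc (suc a + b + suc c)
  total = solve-∀
  visits′ : path ↭ range 0 (suc (suc a + b + suc c))
  visits′ = begin
      xs ++ u ∷ suc M ∷ v ∷ ys
        ≡⟨ List.++-assoc xs [ u ] _ ⟨
      (xs ∷ʳ u) ++ suc M ∷ v ∷ ys
        ↭⟨ ↭-insert-max (xs ∷ʳ u) (v ∷ ys) (suc M) (subst (_↭ range 0 (suc M)) (sym (List.++-assoc xs [ u ] (v ∷ ys))) visits) ⟩
      range 0 (suc (suc M))
        ≡⟨ cong (range 0) (total a b c) ⟩
      range 0 (suc (suc a + b + suc c)) ∎
    where open PermutationReasoning
  rest : diffs (xs ∷ʳ u) ++ diffs (v ∷ ys) ↭ L1xx1 m a b c
  rest = ↭.drop-∷ (begin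
      m ∷ (diffs (xs ∷ʳ u) ++ diffs (v ∷ ys))   ≡⟨ cong (λ t → t ∷ (diffs (xs ∷ʳ u) ++ diffs (v ∷ ys))) uv≡m ⟨
      absDiff u v ∷ (diffs (xs ∷ʳ u) ++ diffs (v ∷ ys)) ↭⟨ diffs-middle xs u v ys ⟨
      diffs (xs ++ u ∷ v ∷ ys)                  ↭⟨ diffs↭ ⟩
      L1xx1 m a (suc b) c                       ↭⟨ L1xx1-++ m 0 1 0 a b c ⟨
      m ∷ L1xx1 m a b c                         ∎)
    where open PermutationReasoning
  diffs′ : diffs path ↭ L1xx1 m (suc a) b (suc c)
  diffs′ = begin
      diffs path
        ↭⟨ diffs-insert xs u (suc M) v ys ⟩
      absDiff u (suc M) ∷ absDiff (suc M) v ∷ (diffs (xs ∷ʳ u) ++ diffs (v ∷ ys))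
        ↭⟨ ↭.++⁺ around rest ⟩
      1 ∷ suc m ∷ L1xx1 m a b c
        ↭⟨ L1xx1-++ m 1 0 1 a b c ⟩
      L1xx1 m (suc a) b (suc c) ∎
    where open PermutationReasoning

extendAtMax : ∀ {m a b c} w (r : Realization m a (suc b) c) → a + suc b + c ≡ m + w →
  (a + suc b + c , w) ∈ steps (Realization.path r) ⊎ (w , a + suc b + c) ∈ steps (Realization.path r) →
  Realization m (suc a) b (suc c)
extendAtMax {m} {a} {b} {c} w r M≡ (inj₁ Mw∈) with ∈-steps⇒middle _ Mw∈
... | xs , ys , eq = insertMax r xs M w ys eq
  (trans (cong (λ t → absDiff t w) M≡) (absDiff-+ˡ w m))
  (↭-reflexive (cong₂ (λ s t → s ∷ t ∷ []) (absDiff-suc M) (trans (cong (λ t → absDiff (suc t) w) M≡) (absDiff-+ˡ w (suc m)))))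
  where
  M : ℕ
  M = a + suc b + c
extendAtMax {m} {a} {b} {c} w r M≡ (inj₂ wM∈) with ∈-steps⇒middle _ wM∈
... | xs , ys , eq = insertMax r xs w M ys eq
  (trans (cong (absDiff w) M≡) (absDiff-+ʳ w m))
  (↭-trans (↭-reflexive (cong₂ (λ s t → s ∷ t ∷ []) (trans (cong (λ t → absDiff w (suc t)) M≡) (absDiff-+ʳ w (suc m))) (absDiff-sucˡ M)))
           (swap (suc m) 1 ↭-refl))
  where
  M : ℕ
  M = a + suc b + c

map-pairDiff-verticals : ∀ m n → map pairDiff (map (vertical m) (range 0 n)) ≡ replicate n m
map-pairDiff-verticals m n = trans (sym (List.map-∘ (range 0 n))) (from 0 n)
  where
  from : ∀ s n → map (pairDiff ∘ vertical m) (range s n) ≡ replicate n m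
  from s zero    = refl
  from s (suc n) = cong₂ _∷_ (absDiff-+ʳ s m) (from (suc s) n)

-- Exactly the verticals starting below j cross the spliced value j.
map-pairDiff-punchIn-verticals : ∀ m j n → j ≤ m → j ≤ n →
  map pairDiff (map (punchIn² j) (map (vertical m) (range 0 n))) ≡ replicate j (suc m) ++ replicate (n ∸ j) m
map-pairDiff-punchIn-verticals m j n j≤m j≤n = begin
    map pairDiff (map (punchIn² j) (map (vertical m) (range 0 n)))
      ≡⟨ trans (sym (List.map-∘ _)) (sym (List.map-∘ (range 0 n))) ⟩
    map F (range 0 n)
      ≡⟨ cong (map F) (trans (cong (range 0) (sym (ℕ.m+[n∸m]≡n j≤n))) (range-++ 0 j (n ∸ j))) ⟩
    map F (range 0 j ++ range j (n ∸ j))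
      ≡⟨ List.map-++ F (range 0 j) (range j (n ∸ j)) ⟩
    map F (range 0 j) ++ map F (range j (n ∸ j))
      ≡⟨ cong₂ _++_ (trans (map-constant F (range 0 j) (All-range 0 j (λ c _ c<j → crossing c c<j))) (cong (λ t → replicate t (suc m)) (length-range 0 j)))
                    (trans (map-constant F (range j (n ∸ j)) (All-range j (n ∸ j) (λ c j≤c _ → above c j≤c))) (cong (λ t → replicate t m) (length-range j (n ∸ j)))) ⟩
    replicate j (suc m) ++ replicate (n ∸ j) m ∎
  where
  open ≡-Reasoning
  F : ℕ → ℕ
  F = pairDiff ∘ punchIn² j ∘ vertical m
  crossing : ∀ c → c < j → F c ≡ suc m
  crossing c c<j = trans (cong₂ absDiff (punchIn-< c<j) (punchIn-≥ (ℕ.≤-trans j≤m (ℕ.m≤m+n m c)))) (absDiff-+ʳ c (suc m))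
  above : ∀ c → j ≤ c → F c ≡ m
  above c j≤c = trans (cong₂ absDiff (punchIn-≥ j≤c) (punchIn-≥ (ℕ.≤-trans j≤c (ℕ.m≤n+m c m)))) (absDiff-+ʳ c m)

diffs-splice : ∀ j xs ys → NonEmpty xs → NonEmpty ys →
  diffs (splice j xs ys) ↭ absDiff (punchIn j (lastD xs)) j ∷ absDiff j (punchIn j (headD ys)) ∷ map pairDiff (map (punchIn² j) (steps xs ++ steps ys))
diffs-splice j xs ys nexs neys = begin
    diffs (splice j xs ys)
      ≡⟨ trans (diffs≡map-pairDiff-steps _) (cong (map pairDiff) (steps-splice j xs ys nexs neys)) ⟩
    map pairDiff (SA ++ X ∷ Y ∷ SB)
      ≡⟨ List.map-++ pairDiff SA _ ⟩
    map pairDiff SA ++ pairDiff X ∷ pairDiff Y ∷ map pairDiff SB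
      ↭⟨ ↭.shifts (map pairDiff SA) (pairDiff X ∷ pairDiff Y ∷ []) ⟩
    pairDiff X ∷ pairDiff Y ∷ (map pairDiff SA ++ map pairDiff SB)
      ≡⟨ cong (λ t → pairDiff X ∷ pairDiff Y ∷ t) (trans (sym (List.map-++ pairDiff SA SB)) (cong (map pairDiff) (sym (List.map-++ (punchIn² j) (steps xs) (steps ys))))) ⟩
    pairDiff X ∷ pairDiff Y ∷ map pairDiff (map (punchIn² j) (steps xs ++ steps ys)) ∎
  where
  open PermutationReasoning
  SA SB : List (ℕ × ℕ)
  SA = map (punchIn² j) (steps xs)
  SB = map (punchIn² j) (steps ys)
  X Y : ℕ × ℕ
  X = (punchIn j (lastD xs) , j)
  Y = (j , punchIn j (headD ys))

-- A snake runs through the columns of the m-column grid on [0, m + n) in the order ord, each column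
-- upwards or downwards according to dir.
module Snake (m′ K R : ℕ) (R≤m : R ≤ suc m′) (dir : ℕ → Bool) where

  m n : ℕ
  m = suc m′
  n = K * m + R

  rows : ℕ → ℕ
  rows c = K + extra R c

  top : ℕ → ℕ
  top c = rows c * m + c

  segment : ℕ → List ℕ
  segment c = orient (dir c) (column m c (suc (rows c)))

  snake : List ℕ → List ℕ
  snake ord = concat (map segment ord)

  junction : ℕ → ℕ → ℕ × ℕ
  junction c c′ = (lastD (segment c) , headD (segment c′))

  verticals : List (ℕ × ℕ)
  verticals = map (vertical m) (range 0 n)

  NonEmpty-segment : ∀ c → NonEmpty (segment c)
  NonEmpty-segment c = NonEmpty-orient (dir c) c _

  All-NonEmpty : ∀ ord → All NonEmpty (map segment ord)
  All-NonEmpty []        = []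
  All-NonEmpty (c ∷ ord) = NonEmpty-segment c ∷ All-NonEmpty ord

  segment-ends-↑ : ∀ c → dir c ≡ true → headD (segment c) ≡ c × lastD (segment c) ≡ top c
  segment-ends-↑ c d rewrite d = refl , lastD-column m c (rows c)

  segment-ends-↓ : ∀ c → dir c ≡ false → headD (segment c) ≡ top c × lastD (segment c) ≡ c
  segment-ends-↓ c d rewrite d = trans (headD-reverse (column m c (suc (rows c)))) (lastD-column m c (rows c))
                               , lastD-reverse (column m c (suc (rows c)))

  snake-++ : ∀ P Q → snake (P ++ Q) ≡ snake P ++ snake Q
  snake-++ P Q = trans (cong concat (List.map-++ segment P Q)) (sym (List.concat-++ (map segment P) (map segment Q)))

  NonEmpty-snake : ∀ c ord → NonEmpty (snake (c ∷ ord))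
  NonEmpty-snake c ord = NonEmpty-++ (segment c) _ (NonEmpty-segment c)

  headD-snake : ∀ c ord → headD (snake (c ∷ ord)) ≡ headD (segment c)
  headD-snake c ord = headD-++ (segment c) _ (NonEmpty-segment c)

  lastD-snake : ∀ ord c → lastD (snake (ord ∷ʳ c)) ≡ lastD (segment c)
  lastD-snake ord c = begin
      lastD (snake (ord ∷ʳ c))                  ≡⟨ cong lastD (snake-++ ord [ c ]) ⟩
      lastD (snake ord ++ (segment c ++ []))    ≡⟨ lastD-++ (snake ord) (segment c ++ []) (NonEmpty-++ (segment c) [] (NonEmpty-segment c)) ⟩
      lastD (segment c ++ [])                   ≡⟨ cong lastD (List.++-identityʳ (segment c)) ⟩
      lastD (segment c)                         ∎
    where open ≡-Reasoning

  ∈-steps-snake : ∀ {p c} ord → c ∈ ord → p ∈ steps (segment c) → p ∈ steps (snake ord)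
  ∈-steps-snake (c ∷ ord) (here refl) p∈ = ∈-steps-++ˡ (segment c) (snake ord) p∈
  ∈-steps-snake (c ∷ ord) (there c∈)  p∈ = ∈-steps-++ʳ (segment c) (snake ord) (∈-steps-snake ord c∈ p∈)

  snake-↭ : ∀ ord → ord ↭ range 0 m → snake ord ↭ range 0 (m + n)
  snake-↭ ord p = begin
      concat (map segment ord)                                ↭⟨ concat-map-pointwise-↭ segment (λ c → column m c (suc (rows c))) ord (λ c → orient-↭ (dir c) _) ⟩
      concat (map (λ c → column m c (suc (rows c))) ord)      ↭⟨ concat-map-↭ (λ c → column m c (suc (rows c))) p ⟩
      concat (map (λ c → column m c (suc (rows c))) (range 0 m)) ↭⟨ columns-tile m (suc K) R R≤m ⟩
      range 0 (suc K * m + R)                                 ≡⟨ cong (range 0) (ℕ.+-assoc m (K * m) R) ⟩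
      range 0 (m + n)                                         ∎
    where open PermutationReasoning

  segments-steps : ∀ ord → ord ↭ range 0 m → concat (map steps (map segment ord)) ≈ verticals
  segments-steps ord p =
    ≈-trans (≡⇒≈ (cong concat (sym (List.map-∘ ord))))
    (≈-trans (concat-map-≈ (steps ∘ segment) (λ c → map (vertical m) (column m c (rows c))) ord
               (λ c → ≈-trans (steps-orient (dir c) _) (≡⇒≈ (steps-column m c (rows c)))))
    (≈-trans (≡⇒≈ (trans (cong concat (List.map-∘ ord)) (List.concat-map (map (λ c → column m c (rows c)) ord))))
    (↭⇒≈ (↭.map⁺ (vertical m) (↭-trans (concat-map-↭ (λ c → column m c (rows c)) p) (columns-tile m K R R≤m))))))

  snake-steps : ∀ ord → ord ↭ range 0 m → steps (snake ord) ≈ verticals ++ junctions (map segment ord)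
  snake-steps ord p = ≈-trans (↭⇒≈ (steps-concat (map segment ord) (All-NonEmpty ord))) (≈-++ (segments-steps ord p) ≈-refl)

  snake-steps₂ : ∀ P Q → P ++ Q ↭ range 0 m →
    steps (snake P) ++ steps (snake Q) ≈ verticals ++ (junctions (map segment P) ++ junctions (map segment Q))
  snake-steps₂ P Q p =
    ≈-trans (≈-++ (↭⇒≈ (steps-concat (map segment P) (All-NonEmpty P))) (↭⇒≈ (steps-concat (map segment Q) (All-NonEmpty Q))))
    (≈-trans (↭⇒≈ (interchange (concat (map steps (map segment P))) (junctions (map segment P)) (concat (map steps (map segment Q))) _))
    (≈-++ (≈-trans (≡⇒≈ inner≡) (segments-steps (P ++ Q) p)) ≈-refl))
    where
    interchange : ∀ {A : Set} (a b c d : List A) → (a ++ b) ++ (c ++ d) ↭ (a ++ c) ++ (b ++ d)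
    interchange a b c d = begin
        (a ++ b) ++ (c ++ d)   ≡⟨ List.++-assoc a b (c ++ d) ⟩
        a ++ (b ++ (c ++ d))   ↭⟨ ↭.++⁺ˡ a (↭.shifts b c) ⟩
        a ++ (c ++ (b ++ d))   ≡⟨ List.++-assoc a c (b ++ d) ⟨
        (a ++ c) ++ (b ++ d)   ∎
      where open PermutationReasoning
    inner≡ : concat (map steps (map segment P)) ++ concat (map steps (map segment Q)) ≡ concat (map steps (map segment (P ++ Q)))
    inner≡ = trans (List.concat-++ (map steps (map segment P)) _)
                   (cong concat (trans (sym (List.map-++ steps (map segment P) _)) (cong (map steps) (sym (List.map-++ segment P Q)))))

  row-or-first : ∀ h c → h * m + c ≡ c ⊎ m ≤ h * m + c
  row-or-first zero    c = inj₁ refl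
  row-or-first (suc h) c = inj₂ (ℕ.≤-trans (ℕ.m≤m+n m (h * m)) (ℕ.m≤m+n (m + h * m) c))

  top-suc : ∀ c → extra R c ≡ extra R (suc c) → top (suc c) ≡ suc (top c)
  top-suc c same = trans (cong (λ t → (K + t) * m + suc c) (sym same)) (ℕ.+-suc (rows c * m) c)

  joins-bottom : ∀ c → dir c ≡ false → dir (suc c) ≡ true → Joins m c (junction c (suc c))
  joins-bottom c d d′ =
    subst (Joins m c) (sym (cong₂ _,_ (proj₂ (segment-ends-↓ c d)) (proj₁ (segment-ends-↑ (suc c) d′)))) (rise c (inj₁ refl))

  joins-top : ∀ c → dir c ≡ true → dir (suc c) ≡ false → extra R c ≡ extra R (suc c) → Joins m c (junction c (suc c))
  joins-top c d d′ same =
    subst (Joins m c) (sym (cong₂ _,_ (proj₂ (segment-ends-↑ c d)) (trans (proj₁ (segment-ends-↓ (suc c) d′)) (top-suc c same))))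
      (rise (top c) (row-or-first (rows c) c))

  joins-bottomᵣ : ∀ c → dir (suc c) ≡ false → dir c ≡ true → Joins m c (junction (suc c) c)
  joins-bottomᵣ c d d′ =
    subst (Joins m c) (sym (cong₂ _,_ (proj₂ (segment-ends-↓ (suc c) d)) (proj₁ (segment-ends-↑ c d′)))) (fall c (inj₁ refl))

  joins-topᵣ : ∀ c → dir (suc c) ≡ true → dir c ≡ false → extra R c ≡ extra R (suc c) → Joins m c (junction (suc c) c)
  joins-topᵣ c d d′ same =
    subst (Joins m c) (sym (cong₂ _,_ (trans (proj₂ (segment-ends-↑ (suc c) d)) (top-suc c same)) (proj₁ (segment-ends-↓ c d′))))
      (fall (top c) (row-or-first (rows c) c))

  unit-steps : ∀ {J} → All (λ e → ∃ λ c → Joins m c e) J → map pairDiff J ≡ replicate (length J) 1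
  unit-steps js = map-constant pairDiff _ (All.map (λ e → pairDiff-Joins (proj₂ e)) js)

  snakeRealization : ∀ ord → 0 ∷ ord ↭ range 0 m → dir 0 ≡ true →
    All (λ e → ∃ λ c → Joins m c e) (junctions (map segment (0 ∷ ord))) → Realization m m′ n 0
  snakeRealization ord p d₀ js =
    realization (snake (0 ∷ ord)) (NonEmpty-snake 0 ord) (trans (headD-snake 0 ord) (proj₁ (segment-ends-↑ 0 d₀)))
      (↭-trans (snake-↭ (0 ∷ ord) p) (↭-reflexive (cong (range 0) (total m′ n)))) diffs↭
    where
    J : List (ℕ × ℕ)
    J = junctions (map segment (0 ∷ ord))
    total : ∀ a b → suc a + b ≡ suc (a + b + 0)
    total = solve-∀
    length-J : length J ≡ m′
    length-J = trans (length-junctions (segment 0) (map segment ord))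
      (trans (List.length-map segment ord) (ℕ.suc-injective (trans (↭.↭-length p) (length-range 0 m))))
    diffs↭ : diffs (snake (0 ∷ ord)) ↭ L1xx1 m m′ n 0
    diffs↭ = begin
        diffs (snake (0 ∷ ord))                   ↭⟨ diffs-≈ _ _ (snake-steps (0 ∷ ord) p) ⟩
        map pairDiff (verticals ++ J)             ≡⟨ List.map-++ pairDiff verticals J ⟩
        map pairDiff verticals ++ map pairDiff J  ≡⟨ cong₂ _++_ (map-pairDiff-verticals m n) (trans (unit-steps js) (cong (λ t → replicate t 1) length-J)) ⟩
        replicate n m ++ replicate m′ 1           ↭⟨ ↭.++-comm (replicate n m) (replicate m′ 1) ⟩
        replicate m′ 1 ++ replicate n m           ≡⟨ cong (replicate m′ 1 ++_) (sym (List.++-identityʳ (replicate n m))) ⟩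
        L1xx1 m m′ n 0                            ∎
      where open PermutationReasoning

  length-junctions₂ : ∀ p P q Q → (p ∷ P) ++ (q ∷ Q) ↭ range 0 m →
    suc (suc (length (junctions (map segment (p ∷ P)) ++ junctions (map segment (q ∷ Q))))) ≡ m
  length-junctions₂ p P q Q pq = begin
      suc (suc (length (junctions (map segment (p ∷ P)) ++ junctions (map segment (q ∷ Q)))))
        ≡⟨ cong (suc ∘ suc) (trans (List.length-++ (junctions (map segment (p ∷ P))))
              (cong₂ _+_ (trans (length-junctions (segment p) (map segment P)) (List.length-map segment P))
                         (trans (length-junctions (segment q) (map segment Q)) (List.length-map segment Q)))) ⟩
      suc (suc (length P + length Q))
        ≡⟨ cong suc (sym (ℕ.+-suc (length P) (length Q))) ⟩
      suc (length P + suc (length Q))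
        ≡⟨ cong suc (sym (List.length-++ P)) ⟩
      length ((p ∷ P) ++ (q ∷ Q))
        ≡⟨ trans (↭.↭-length pq) (length-range 0 m) ⟩
      m ∎
    where open ≡-Reasoning

  -- Splicing j between the snakes through (p ∷ P) and (q ∷ Q) turns the j verticals below j into
  -- (m + 1)-steps and the junction between the two snakes into two unit steps.
  diffs-splice-snakes : ∀ j t p P q Q → (p ∷ P) ++ (q ∷ Q) ↭ range 0 m → n ≡ j + t → j ≤ m →
    absDiff (punchIn j (lastD (snake (p ∷ P)))) j ≡ 1 →
    absDiff j (punchIn j (headD (snake (q ∷ Q)))) ≡ 1 →
    All (λ e → ∃ λ c → suc c ≢ j × Joins m c e) (junctions (map segment (p ∷ P)) ++ junctions (map segment (q ∷ Q))) →
    diffs (splice j (snake (p ∷ P)) (snake (q ∷ Q))) ↭ L1xx1 m m t j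
  diffs-splice-snakes j t p P q Q pq n≡ j≤m left right js = begin
      diffs (splice j A B)
        ↭⟨ diffs-splice j A B (NonEmpty-snake p P) (NonEmpty-snake q Q) ⟩
      _ ∷ _ ∷ map pairDiff (map (punchIn² j) (steps A ++ steps B))
        ≡⟨ cong₂ (λ u v → u ∷ v ∷ map pairDiff (map (punchIn² j) (steps A ++ steps B))) left right ⟩
      1 ∷ 1 ∷ map pairDiff (map (punchIn² j) (steps A ++ steps B))
        ↭⟨ prep 1 (prep 1 (≈-map (punchIn j) (snake-steps₂ (p ∷ P) (q ∷ Q) pq) absDiff absDiff-comm)) ⟩
      1 ∷ 1 ∷ map pairDiff (map (punchIn² j) (verticals ++ J))
        ≡⟨ cong (λ s → 1 ∷ 1 ∷ s) (trans (cong (map pairDiff) (List.map-++ (punchIn² j) verticals J))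
                                        (List.map-++ pairDiff (map (punchIn² j) verticals) (map (punchIn² j) J))) ⟩
      1 ∷ 1 ∷ (map pairDiff (map (punchIn² j) verticals) ++ map pairDiff (map (punchIn² j) J))
        ≡⟨ cong₂ (λ s u → 1 ∷ 1 ∷ (s ++ u)) (map-pairDiff-punchIn-verticals m j n j≤m j≤n) spliced-junctions ⟩
      1 ∷ 1 ∷ ((replicate j (suc m) ++ replicate (n ∸ j) m) ++ replicate (length J) 1)
        ↭⟨ prep 1 (prep 1 (↭-trans (↭.++-comm (replicate j (suc m) ++ replicate (n ∸ j) m) (replicate (length J) 1))
                                  (↭.++⁺ˡ (replicate (length J) 1) (↭.++-comm (replicate j (suc m)) (replicate (n ∸ j) m))))) ⟩
      replicate (suc (suc (length J))) 1 ++ replicate (n ∸ j) m ++ replicate j (suc m)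
        ≡⟨ cong₂ (λ s u → replicate s 1 ++ replicate u m ++ replicate j (suc m))
                 (length-junctions₂ p P q Q pq) (trans (cong (_∸ j) n≡) (ℕ.m+n∸m≡n j t)) ⟩
      L1xx1 m m t j ∎
    where
    open PermutationReasoning
    A B : List ℕ
    A = snake (p ∷ P)
    B = snake (q ∷ Q)
    J : List (ℕ × ℕ)
    J = junctions (map segment (p ∷ P)) ++ junctions (map segment (q ∷ Q))
    j≤n : j ≤ n
    j≤n = subst (j ≤_) (sym n≡) (ℕ.m≤m+n j t)
    spliced-junctions : map pairDiff (map (punchIn² j) J) ≡ replicate (length J) 1
    spliced-junctions = trans (sym (List.map-∘ J))
      (map-constant (pairDiff ∘ punchIn² j) J (All.map (λ e → pairDiff-punchIn-Joins j j≤m (proj₁ (proj₂ e)) (proj₂ (proj₂ e))) js))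

  spliceRealization : ∀ j t p P q Q → (p ∷ P) ++ (q ∷ Q) ↭ range 0 m → n ≡ j + t → 0 < j → j ≤ m →
    headD (segment p) ≡ 0 →
    absDiff (punchIn j (lastD (snake (p ∷ P)))) j ≡ 1 →
    absDiff j (punchIn j (headD (snake (q ∷ Q)))) ≡ 1 →
    All (λ e → ∃ λ c → suc c ≢ j × Joins m c e) (junctions (map segment (p ∷ P)) ++ junctions (map segment (q ∷ Q))) →
    Realization m m t j
  spliceRealization j t p P q Q pq n≡ 0<j j≤m start₀ left right js =
    realization (splice j A B) (NonEmpty-++ _ _ (NonEmpty-map (punchIn j) A (NonEmpty-snake p P))) start visits
      (diffs-splice-snakes j t p P q Q pq n≡ j≤m left right js)
    where
    A B : List ℕ
    A = snake (p ∷ P)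
    B = snake (q ∷ Q)
    start : headD (splice j A B) ≡ 0
    start = begin
        headD (splice j A B)          ≡⟨ headD-++ (map (punchIn j) A) _ (NonEmpty-map (punchIn j) A (NonEmpty-snake p P)) ⟩
        headD (map (punchIn j) A)     ≡⟨ headD-map (punchIn j) A (NonEmpty-snake p P) ⟩
        punchIn j (headD A)           ≡⟨ cong (punchIn j) (trans (headD-snake p P) start₀) ⟩
        punchIn j 0                   ≡⟨ punchIn-< 0<j ⟩
        0                             ∎
      where open ≡-Reasoning
    total : ∀ m′ j t → suc (suc (m′ + (j + t))) ≡ suc (suc m′ + t + j)
    total = solve-∀
    visits : splice j A B ↭ range 0 (suc (m + t + j))
    visits = ↭-trans (splice-↭ j A B (m′ + n) (subst (_↭ range 0 (m + n)) (snake-++ (p ∷ P) (q ∷ Q)) (snake-↭ _ pq))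
                                  (ℕ.≤-trans (subst (j ≤_) (sym n≡) (ℕ.m≤m+n j t)) (ℕ.m≤n+m n m′)))
                     (↭-reflexive (cong (range 0) (trans (cong (λ s → suc (suc (m′ + s))) n≡) (total m′ j t))))

  top-step : ∀ c → c < R → (suc K * m + c , K * m + c) ∈ steps (segment c) ⊎ (K * m + c , suc K * m + c) ∈ steps (segment c)
  top-step c c<R =
    subst (λ xs → (suc K * m + c , K * m + c) ∈ steps (orient (dir c) xs) ⊎ (K * m + c , suc K * m + c) ∈ steps (orient (dir c) xs))
      (sym tall) (orient-last-two (dir c) (column m c K) (K * m + c) (suc K * m + c))
    where
    tall : column m c (suc (rows c)) ≡ column m c K ++ (K * m + c) ∷ (suc K * m + c) ∷ []
    tall = trans (cong (λ h → column m c (suc h)) (trans (cong (K +_) (extra-< c<R)) (ℕ.+-comm K 1))) (column-last-two m c K)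

  ∈-columns : ∀ {c} ord → ord ↭ range 0 m → c < m → c ∈ ord
  ∈-columns ord p c<m = ↭.∈-resp-↭ (↭-sym p) (∈-range 0 m z≤n c<m)

  -- The last tall column r ends at the maximum, so the snake can be extended there.
  snakeExtension : ∀ ord r → 0 ∷ ord ↭ range 0 m → dir 0 ≡ true →
    All (λ e → ∃ λ c → Joins m c e) (junctions (map segment (0 ∷ ord))) → R ≡ suc r →
    Realization m (suc m′) (K * m + r) 1
  snakeExtension ord r p d₀ js R≡ = extendAtMax (K * m + r) S (M≡ m′ K r)
    (subst (λ M → (M , w) ∈ steps (snake (0 ∷ ord)) ⊎ (w , M) ∈ steps (snake (0 ∷ ord))) (top≡ m′ K r) mem)
    where
    w : ℕ
    w = K * m + r
    S : Realization m m′ (suc w) 0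
    S = realization-cast refl (trans (cong (K * m +_) R≡) (ℕ.+-suc (K * m) r)) refl (snakeRealization ord p d₀ js)
    M≡ : ∀ m′ K r → m′ + suc (K * suc m′ + r) + 0 ≡ suc m′ + (K * suc m′ + r)
    M≡ = solve-∀
    top≡ : ∀ m′ K r → suc K * suc m′ + r ≡ m′ + suc (K * suc m′ + r) + 0
    top≡ = solve-∀
    r<R : r < R
    r<R = subst (r <_) (sym R≡) (ℕ.n<1+n r)
    mem : (suc K * m + r , w) ∈ steps (snake (0 ∷ ord)) ⊎ (w , suc K * m + r) ∈ steps (snake (0 ∷ ord))
    mem = Sum.map (∈-steps-snake (0 ∷ ord) r∈) (∈-steps-snake (0 ∷ ord) r∈) (top-step r r<R)
      where
      r∈ : r ∈ 0 ∷ ord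
      r∈ = ∈-columns (0 ∷ ord) p (ℕ.<-≤-trans r<R R≤m)

  spliceExtension : ∀ j t′ p P q Q r → (p ∷ P) ++ (q ∷ Q) ↭ range 0 m → n ≡ j + suc t′ → 0 < j → j ≤ m →
    headD (segment p) ≡ 0 →
    absDiff (punchIn j (lastD (snake (p ∷ P)))) j ≡ 1 →
    absDiff j (punchIn j (headD (snake (q ∷ Q)))) ≡ 1 →
    All (λ e → ∃ λ c → suc c ≢ j × Joins m c e) (junctions (map segment (p ∷ P)) ++ junctions (map segment (q ∷ Q))) →
    R ≡ suc r → j ≤ K * m + r →
    Realization m (suc m) t′ (suc j)
  spliceExtension j t′ p P q Q r pq n≡ 0<j j≤m start₀ left right js R≡ j≤w =
    extendAtMax (suc w) (spliceRealization j (suc t′) p P q Q pq n≡ 0<j j≤m start₀ left right js) M≡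
      (subst (λ M → (M , suc w) ∈ steps (splice j A B) ⊎ (suc w , M) ∈ steps (splice j A B)) top≡ mem)
    where
    w : ℕ
    w = K * m + r
    A B : List ℕ
    A = snake (p ∷ P)
    B = snake (q ∷ Q)
    suc-w≡ : suc w ≡ j + suc t′
    suc-w≡ = trans (sym (trans (cong (K * m +_) R≡) (ℕ.+-suc (K * m) r))) n≡
    M≡ : m + suc t′ + j ≡ m + suc w
    M≡ = trans (ℕ.+-assoc m (suc t′) j) (cong (m +_) (trans (ℕ.+-comm (suc t′) j) (sym suc-w≡)))
    top≡ : suc (suc K * m + r) ≡ m + suc t′ + j
    top≡ = trans (cong suc (ℕ.+-assoc m (K * m) r)) (trans (sym (ℕ.+-suc m w)) (sym M≡))
    j≤top : j ≤ suc K * m + r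
    j≤top = ℕ.≤-trans j≤w (subst (w ≤_) (sym (ℕ.+-assoc m (K * m) r)) (ℕ.m≤n+m w m))
    r<R : r < R
    r<R = subst (r <_) (sym R≡) (ℕ.n<1+n r)
    lift : ∀ {e} → e ∈ steps (segment r) → punchIn² j e ∈ steps (splice j A B)
    lift e∈ with ∈.∈-++⁻ (p ∷ P) (∈-columns ((p ∷ P) ++ (q ∷ Q)) pq (ℕ.<-≤-trans r<R R≤m))
    ... | inj₁ r∈P = ∈-steps-splice j A B (NonEmpty-snake p P) (NonEmpty-snake q Q) (inj₁ (∈-steps-snake (p ∷ P) r∈P e∈))
    ... | inj₂ r∈Q = ∈-steps-splice j A B (NonEmpty-snake p P) (NonEmpty-snake q Q) (inj₂ (∈-steps-snake (q ∷ Q) r∈Q e∈))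
    mem : (suc (suc K * m + r) , suc w) ∈ steps (splice j A B) ⊎ (suc w , suc (suc K * m + r)) ∈ steps (splice j A B)
    mem = Sum.map (λ e∈ → subst (_∈ steps (splice j A B)) (punchIn²-≥ j≤top j≤w) (lift e∈))
                  (λ e∈ → subst (_∈ steps (splice j A B)) (punchIn²-≥ j≤w j≤top) (lift e∈))
                  (top-step r r<R)

isEven : ℕ → Bool
isEven zero    = true
isEven (suc n) = not (isEven n)

isEven-+ : ∀ a b → isEven (a + b) ≡ (if isEven a then isEven b else not (isEven b))
isEven-+ zero    b = refl
isEven-+ (suc a) b = trans (cong not (isEven-+ a b)) (flip-branches (isEven a) (isEven b))
  where
  flip-branches : ∀ p q → not (if p then q else not q) ≡ (if not p then q else not q)
  flip-branches true  q = refl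
  flip-branches false q = Bool.not-involutive q

isEven-+-even : ∀ a b → isEven a ≡ true → isEven (a + b) ≡ isEven b
isEven-+-even a b e = trans (isEven-+ a b) (cong (λ p → if p then isEven b else not (isEven b)) e)

isEven-+-evenʳ : ∀ j t → isEven t ≡ true → isEven (j + t) ≡ isEven j
isEven-+-evenʳ j t e = trans (cong isEven (ℕ.+-comm j t)) (isEven-+-even t j e)

isEven-*-even : ∀ k m → isEven m ≡ true → isEven (k * m) ≡ true
isEven-*-even zero    m e = refl
isEven-*-even (suc k) m e = trans (isEven-+-even m (k * m) e) (isEven-*-even k m e)

isEven-∸ : ∀ x R → R ≤ x → isEven x ≡ true → isEven (x ∸ R) ≡ isEven R
isEven-∸ x R R≤x e = cases (isEven R) (isEven (x ∸ R)) (trans (sym (isEven-+ R (x ∸ R))) (trans (cong isEven (ℕ.m+[n∸m]≡n R≤x)) e))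
  where
  cases : ∀ p q → (if p then q else not q) ≡ true → q ≡ p
  cases true  true  _ = refl
  cases false false _ = refl

Bool-cases : ∀ b → b ≡ true ⊎ b ≡ false
Bool-cases true  = inj₁ refl
Bool-cases false = inj₂ refl

isEven-pred : ∀ c {b} → isEven (suc c) ≡ b → isEven c ≡ not b
isEven-pred c e = trans (sym (Bool.not-involutive (isEven c))) (cong not e)

parity-≢ : ∀ {u v} → isEven u ≡ true → isEven v ≡ false → u ≢ v
parity-≢ eu ev u≡v with () ← trans (sym eu) (trans (cong isEven u≡v) ev)

-- Columns in increasing order, the even ones upwards.
module Ascending (m′ K R : ℕ) (R≤m : R ≤ suc m′) (R-ok : ∀ c → isEven c ≡ true → suc c < suc m′ → suc c ≢ R) where

  open Snake m′ K R R≤m isEven public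

  ascendingJoins : ∀ c → suc c < m → Joins m c (junction c (suc c))
  ascendingJoins c sc<m with Bool-cases (isEven c)
  ... | inj₁ e = joins-top c e (cong not e) (extra-suc R c (R-ok c e sc<m))
  ... | inj₂ e = joins-bottom c e (cong not e)

  ascendingJunctions : ∀ {P : ℕ × ℕ → Set} s k → s + k < m → (∀ c → s ≤ c → c < s + k → Joins m c (junction c (suc c)) → P (junction c (suc c))) →
    All P (junctions (map segment (range s (suc k))))
  ascendingJunctions s k s+k<m h = subst (All _) (sym (junctions-range segment s k))
    (Allₚ.map⁺ (All-range s k (λ c s≤c c<s+k → h c s≤c c<s+k (ascendingJoins c (ℕ.≤-<-trans c<s+k s+k<m)))))

  ascendingRealization : Realization m m′ n 0
  ascendingRealization = snakeRealization (range 1 m′) ↭-refl refl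
    (ascendingJunctions 0 m′ ℕ.≤-refl (λ c _ _ jn → c , jn))

  lastD-ascending : isEven m′ ≡ true → lastD (snake (range 0 m)) ≡ top m′
  lastD-ascending ev = trans (cong (lastD ∘ snake) (range-∷ʳ 0 m′)) (trans (lastD-snake (range 0 m′) m′) (proj₂ (segment-ends-↑ m′ ev)))

  ascendingExtension : ∀ r → R ≡ suc r → Realization m (suc m′) (K * m + r) 1
  ascendingExtension r R≡ = snakeExtension (range 1 m′) r ↭-refl refl (ascendingJunctions 0 m′ ℕ.≤-refl (λ c _ _ jn → c , jn)) R≡

  module AscendingSplit (i k : ℕ) (ik≡m : suc i + suc k ≡ m) (ev : isEven (suc i) ≡ true) where

    split-↭ : range 0 (suc i) ++ range (suc i) (suc k) ↭ range 0 m
    split-↭ = ↭-reflexive (trans (sym (range-++ 0 (suc i) (suc k))) (cong (range 0) ik≡m))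

    j≤m : suc i ≤ m
    j≤m = subst (suc i ≤_) ik≡m (ℕ.m≤m+n (suc i) (suc k))

    left : absDiff (punchIn (suc i) (lastD (snake (range 0 (suc i))))) (suc i) ≡ 1
    left = trans (cong (λ v → absDiff (punchIn (suc i) v) (suc i)) last≡) (trans (cong (λ v → absDiff v (suc i)) (punchIn-< (ℕ.n<1+n i))) (absDiff-suc i))
      where
      last≡ : lastD (snake (range 0 (suc i))) ≡ i
      last≡ = trans (cong (lastD ∘ snake) (range-∷ʳ 0 i)) (trans (lastD-snake (range 0 i) i) (proj₂ (segment-ends-↓ i (isEven-pred i ev))))

    right : absDiff (suc i) (punchIn (suc i) (headD (snake (range (suc i) (suc k))))) ≡ 1
    right = trans (cong (λ v → absDiff (suc i) (punchIn (suc i) v)) (trans (headD-snake (suc i) (range (suc (suc i)) k)) (proj₁ (segment-ends-↑ (suc i) ev))))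
                  (trans (cong (absDiff (suc i)) (punchIn-≥ ℕ.≤-refl)) (absDiff-suc (suc i)))

    junctions-avoid : All (λ e → ∃ λ c → suc c ≢ suc i × Joins m c e)
      (junctions (map segment (range 0 (suc i))) ++ junctions (map segment (range (suc i) (suc k))))
    junctions-avoid = Allₚ.++⁺
      (ascendingJunctions 0 i (ℕ.≤-trans (ℕ.n<1+n i) j≤m) (λ c _ c<i jn → c , ℕ.<⇒≢ (s≤s c<i) , jn))
      (ascendingJunctions (suc i) k (subst (_≤ m) (ℕ.+-suc (suc i) k) (ℕ.≤-reflexive ik≡m))
        (λ c j≤c _ jn → c , (ℕ.<⇒≢ (s≤s j≤c) ∘ sym) , jn))

  ascendingSplice : ∀ i k t → suc i + suc k ≡ m → isEven (suc i) ≡ true → n ≡ suc i + t → Realization m m t (suc i)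
  ascendingSplice i k t ik≡m ev n≡ =
    spliceRealization (suc i) t 0 (range 1 i) (suc i) (range (suc (suc i)) k) split-↭ n≡ (s≤s z≤n) j≤m refl left right junctions-avoid
    where open AscendingSplit i k ik≡m ev

  ascendingSpliceExtension : ∀ i k t′ r → suc i + suc k ≡ m → isEven (suc i) ≡ true → n ≡ suc i + suc t′ →
    R ≡ suc r → suc i ≤ K * m + r → Realization m (suc m) t′ (suc (suc i))
  ascendingSpliceExtension i k t′ r ik≡m ev n≡ R≡ j≤w =
    spliceExtension (suc i) t′ 0 (range 1 i) (suc i) (range (suc (suc i)) k) r split-↭ n≡ (s≤s z≤n) j≤m refl left right junctions-avoid R≡ j≤w
    where open AscendingSplit i k ik≡m ev

dirDescending : ℕ → ℕ → Bool
dirDescending m zero    = true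
dirDescending m (suc c) = isEven (m ∸ suc c)

-- Column 0 upwards, then columns m - 1, ..., 1 with directions alternating so that column m - 1 is
-- entered from the bottom.
module Descending (m″ K R : ℕ) (1≤R : 1 ≤ R) (R<m : R < suc (suc m″))
                  (odd-gap : isEven (suc (suc m″) ∸ R) ≡ false) where

  open Snake (suc m″) K R (ℕ.<⇒≤ R<m) (dirDescending (suc (suc m″))) public

  dir : ℕ → Bool
  dir = dirDescending m

  dir-alternates : ∀ c → 1 ≤ c → c < m → dir c ≡ not (dir (suc c))
  dir-alternates (suc c) _ (s≤s c<m′) = cong isEven (ℕ.+-∸-assoc 1 c<m′)

  descendingJoins : ∀ c → 1 ≤ c → suc c < m → Joins m c (junction (suc c) c)
  descendingJoins c 1≤c sc<m with Bool-cases (dir (suc c))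
  ... | inj₁ e = joins-topᵣ c e (trans (dir-alternates c 1≤c (ℕ.<-trans (ℕ.n<1+n c) sc<m)) (cong not e))
                   (extra-suc R c (λ sc≡R → parity-≢ e odd-gap (cong (λ r → m ∸ r) sc≡R)))
  ... | inj₂ e = joins-bottomᵣ c e (trans (dir-alternates c 1≤c (ℕ.<-trans (ℕ.n<1+n c) sc<m)) (cong not e))

  -- The bottom of column 0 lies one above the bottom of column m - 1.
  firstJoins : Joins m (suc m″) (junction 0 (suc m″))
  firstJoins = subst (Joins m (suc m″)) (sym (cong₂ _,_ last₀ head₁)) (fall (K * m + suc m″) (row-or-first K (suc m″)))
    where
    bottom : ∀ K m″ → (K + 1) * suc (suc m″) + 0 ≡ suc (K * suc (suc m″) + suc m″)
    bottom = solve-∀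
    last₀ : lastD (segment 0) ≡ suc (K * m + suc m″)
    last₀ = trans (proj₂ (segment-ends-↑ 0 refl)) (trans (cong (λ t → (K + t) * m + 0) (extra-< 1≤R)) (bottom K m″))
    head₁ : headD (segment (suc m″)) ≡ K * m + suc m″
    head₁ = trans (proj₁ (segment-ends-↓ (suc m″) (cong isEven (ℕ.m+n∸n≡m 1 m″))))
                  (cong (λ t → t * m + suc m″) (trans (cong (K +_) (extra-≥ (ℕ.≤-pred R<m))) (ℕ.+-identityʳ K)))

  descendingJunctions : ∀ {P : ℕ × ℕ → Set} s k → 1 ≤ s → s + k < m →
    (∀ c → s ≤ c → c < s + k → Joins m c (junction (suc c) c) → P (junction (suc c) c)) →
    All P (junctions (map segment (rangeDown s (suc k))))
  descendingJunctions s k 1≤s s+k<m h = subst (All _) (sym (junctions-rangeDown segment s k))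
    (Allₚ.map⁺ (All-rangeDown s k (λ c s≤c c<s+k →
      h c s≤c c<s+k (descendingJoins c (ℕ.≤-trans 1≤s s≤c) (ℕ.≤-<-trans c<s+k s+k<m)))))

  allJoins : All (λ e → ∃ λ c → Joins m c e) (junctions (map segment (0 ∷ rangeDown 1 (suc m″))))
  allJoins = (suc m″ , firstJoins) ∷ descendingJunctions 1 m″ ℕ.≤-refl ℕ.≤-refl (λ c _ _ jn → c , jn)

  order-↭ : 0 ∷ rangeDown 1 (suc m″) ↭ range 0 m
  order-↭ = prep 0 (rangeDown↭range 1 (suc m″))

  descendingRealization : Realization m (suc m″) n 0
  descendingRealization = snakeRealization (rangeDown 1 (suc m″)) order-↭ refl allJoins

  lastD-descending : dir 1 ≡ true → lastD (snake (0 ∷ rangeDown 1 (suc m″))) ≡ top 1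
  lastD-descending d = trans (cong (λ o → lastD (snake (0 ∷ o))) (rangeDown-∷ʳ 1 m″))
    (trans (lastD-snake (0 ∷ rangeDown 2 m″) 1) (proj₂ (segment-ends-↑ 1 d)))

  descendingExtension : ∀ r → R ≡ suc r → Realization m (suc (suc m″)) (K * m + r) 1
  descendingExtension r R≡ = snakeExtension (rangeDown 1 (suc m″)) r order-↭ refl allJoins R≡

  module DescendingSplit (i′ k″ : ℕ) (ik≡m : k″ + suc i′ ≡ m″)
                         (dir-j : dir (suc (suc i′)) ≡ false) (dir-i : dir (suc i′) ≡ true) where

    j : ℕ
    j = suc (suc i′)

    split-↭ : (0 ∷ rangeDown j (suc k″)) ++ rangeDown 1 (suc i′) ↭ range 0 m
    split-↭ = ↭-trans (↭-reflexive (cong (0 ∷_) (trans (sym (rangeDown-++ 1 (suc k″) (suc i′))) (cong (rangeDown 1 ∘ suc) ik≡m)))) order-↭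

    j<m : j < m
    j<m = s≤s (s≤s (subst (suc i′ ≤_) ik≡m (ℕ.m≤n+m (suc i′) k″)))

    left : absDiff (punchIn j (lastD (snake (0 ∷ rangeDown j (suc k″))))) j ≡ 1
    left = trans (cong (λ v → absDiff (punchIn j v) j) last≡) (trans (cong (λ v → absDiff v j) (punchIn-≥ {j} {j} ℕ.≤-refl)) (absDiff-sucˡ j))
      where
      last≡ : lastD (snake (0 ∷ rangeDown j (suc k″))) ≡ j
      last≡ = trans (cong (λ o → lastD (snake (0 ∷ o))) (rangeDown-∷ʳ j k″))
                    (trans (lastD-snake (0 ∷ rangeDown (suc j) k″) j) (proj₂ (segment-ends-↓ j dir-j)))

    right : absDiff j (punchIn j (headD (snake (rangeDown 1 (suc i′))))) ≡ 1
    right = trans (cong (λ v → absDiff j (punchIn j v)) (trans (headD-snake (suc i′) (rangeDown 1 i′)) (proj₁ (segment-ends-↑ (suc i′) dir-i))))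
                  (trans (cong (absDiff j) (punchIn-< {j} {suc i′} ℕ.≤-refl)) (absDiff-sucˡ (suc i′)))

    top-column : j + k″ ≡ suc m″
    top-column = trans (cong suc (ℕ.+-comm (suc i′) k″)) (cong suc ik≡m)

    junctions-avoid : All (λ e → ∃ λ c → suc c ≢ j × Joins m c e)
      (junctions (map segment (0 ∷ rangeDown j (suc k″))) ++ junctions (map segment (rangeDown 1 (suc i′))))
    junctions-avoid = Allₚ.++⁺
      (subst (λ c → ∃ λ c′ → suc c′ ≢ j × Joins m c′ (junction 0 c)) (sym top-column) (suc m″ , (ℕ.<⇒≢ j<m ∘ sym) , firstJoins)
        ∷ descendingJunctions j k″ (s≤s z≤n) (subst (_< m) (sym top-column) ℕ.≤-refl) (λ c j≤c _ jn → c , (ℕ.<⇒≢ (s≤s j≤c) ∘ sym) , jn))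
      (descendingJunctions 1 i′ ℕ.≤-refl (ℕ.<-trans (ℕ.n<1+n (suc i′)) j<m) (λ c _ c<1+i′ jn → c , ℕ.<⇒≢ (s≤s c<1+i′) , jn))

  descendingSplice : ∀ i′ k″ t → k″ + suc i′ ≡ m″ → dir (suc (suc i′)) ≡ false → dir (suc i′) ≡ true →
    n ≡ suc (suc i′) + t → Realization m m t (suc (suc i′))
  descendingSplice i′ k″ t ik≡m dir-j dir-i n≡ =
    spliceRealization j t 0 (rangeDown j (suc k″)) (suc i′) (rangeDown 1 i′) split-↭ n≡ (s≤s z≤n) (ℕ.<⇒≤ j<m) refl left right junctions-avoid
    where open DescendingSplit i′ k″ ik≡m dir-j dir-i

  descendingSpliceExtension : ∀ i′ k″ t′ r → k″ + suc i′ ≡ m″ → dir (suc (suc i′)) ≡ false → dir (suc i′) ≡ true →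
    n ≡ suc (suc i′) + suc t′ → R ≡ suc r → suc (suc i′) ≤ K * m + r → Realization m (suc m) t′ (suc (suc (suc i′)))
  descendingSpliceExtension i′ k″ t′ r ik≡m dir-j dir-i n≡ R≡ j≤w =
    spliceExtension j t′ 0 (rangeDown j (suc k″)) (suc i′) (rangeDown 1 i′) r split-↭ n≡ (s≤s z≤n) (ℕ.<⇒≤ j<m) refl left right junctions-avoid R≡ j≤w
    where open DescendingSplit i′ k″ ik≡m dir-j dir-i

-- Perfect realizations of pure (x + 1)-steps, from snakes with x + 1 columns

asLongSteps : ∀ {x a n} → PerfectRealization (suc x) a n 0 → PerfectRealization x a 0 n
asLongSteps {x} {a} {n} (realization path ne start visits diffs↭ , last≡) =
  realization path ne start (subst (λ k → path ↭ range 0 (suc k)) (total a n) visits)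
    (↭-trans diffs↭ (↭-reflexive (cong (replicate a 1 ++_) (List.++-identityʳ (replicate n (suc x))))))
  , trans last≡ (total a n)
  where
  total : ∀ a n → a + n + 0 ≡ a + 0 + n
  total = solve-∀

perfectAscending : ∀ x K → isEven x ≡ true → PerfectRealization x x 0 (K * suc x + suc x)
perfectAscending x K ev = asLongSteps (ascendingRealization , trans (lastD-ascending ev) top≡)
  where
  open Ascending x K (suc x) ℕ.≤-refl (λ c _ sc<m sc≡m → ℕ.<-irrefl sc≡m sc<m)
  full : ∀ x K → (K + 1) * suc x + x ≡ x + (K * suc x + suc x) + 0
  full = solve-∀
  top≡ : top x ≡ x + (K * suc x + suc x) + 0
  top≡ = trans (cong (λ t → (K + t) * suc x + x) (extra-< (ℕ.n<1+n x))) (full x K)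

perfectDescending : ∀ x₁ K → isEven (suc x₁) ≡ true → 1 ≤ x₁ → PerfectRealization (suc x₁) (suc x₁) 0 (K * suc (suc x₁) + 2)
perfectDescending x₁ K ev 1≤x₁ = asLongSteps (descendingRealization , trans (lastD-descending ev) top≡)
  where
  open Descending x₁ K 2 (s≤s z≤n) (s≤s (s≤s 1≤x₁)) (isEven-pred x₁ ev)
  full : ∀ x₁ K → (K + 1) * suc (suc x₁) + 1 ≡ suc x₁ + (K * suc (suc x₁) + 2) + 0
  full = solve-∀
  top≡ : top 1 ≡ suc x₁ + (K * suc (suc x₁) + 2) + 0
  top≡ = trans (cong (λ t → (K + t) * m + 1) (extra-< {2} {1} (s≤s (s≤s z≤n)))) (full x₁ K)

divide⁺ : ∀ m′ b → 1 ≤ b → ∃₂ λ K R → b ≡ K * suc m′ + R × 1 ≤ R × R ≤ suc m′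
divide⁺ m′ (suc b) _ = b / suc m′ , suc (b % suc m′) , b≡ , s≤s z≤n , m%n<n b (suc m′)
  where
  b≡ : suc b ≡ b / suc m′ * suc m′ + suc (b % suc m′)
  b≡ = trans (cong suc (trans (m≡m%n+[m/n]*n b (suc m′)) (ℕ.+-comm (b % suc m′) _))) (sym (ℕ.+-suc _ (b % suc m′)))

-- Realizations for the even modulus x = m″ + 2

module EvenModulus (m″ : ℕ) (even : isEven (suc (suc m″)) ≡ true) where

  x : ℕ
  x = suc (suc m″)

  isEven-remainder : ∀ {b} K {R} → b ≡ K * x + R → isEven R ≡ isEven b
  isEven-remainder {b} K {R} b≡ = sym (trans (cong isEven b≡) (isEven-+-even (K * x) R (isEven-*-even K x even)))

  isEven-dividend : ∀ j t K {R} → isEven t ≡ true → j + t ≡ K * x + R → isEven j ≡ isEven R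
  isEven-dividend j t K et jt≡ = trans (sym (isEven-+-evenʳ j t et)) (sym (isEven-remainder K jt≡))

  ascending-ok : ∀ {R} → isEven R ≡ true → ∀ c → isEven c ≡ true → suc c < x → suc c ≢ R
  ascending-ok eR c ec _ sc≡R = parity-≢ eR (cong not ec) (sym sc≡R)

  odd-below : ∀ {R} → R ≤ x → isEven R ≡ false → R < x
  odd-below R≤x oR = ℕ.≤∧≢⇒< R≤x (parity-≢ even oR ∘ sym)

  odd-gap : ∀ {R} → R ≤ x → isEven R ≡ false → isEven (x ∸ R) ≡ false
  odd-gap R≤x oR = trans (isEven-∸ x _ R≤x even) oR

  trivialRealization : Realization x 0 0 0
  trivialRealization = realization (0 ∷ []) (nonEmpty 0 []) refl ↭-refl ↭-refl

  noLongSteps : ∀ b → 1 ≤ b → Realization x (suc m″) b 0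
  noLongSteps b 1≤b with divide⁺ (suc m″) b 1≤b
  ... | K , R , b≡ , 1≤R , R≤x with Bool-cases (isEven R)
  ...   | inj₁ eR = realization-cast refl (sym b≡) refl (Ascending.ascendingRealization (suc m″) K R R≤x (ascending-ok eR))
  ...   | inj₂ oR = realization-cast refl (sym b≡) refl (Descending.descendingRealization m″ K R 1≤R (odd-below R≤x oR) (odd-gap R≤x oR))

  oneLongStep : ∀ b → Realization x x b 1
  oneLongStep b with divide⁺ (suc m″) (suc b) (s≤s z≤n)
  ... | K , suc r , b≡ , _ , R≤x with Bool-cases (isEven (suc r))
  ...   | inj₁ eR = realization-cast refl (sym b≡′) refl (Ascending.ascendingExtension (suc m″) K (suc r) R≤x (ascending-ok eR) r refl)
    where
    b≡′ : b ≡ K * x + r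
    b≡′ = ℕ.suc-injective (trans b≡ (ℕ.+-suc (K * x) r))
  ...   | inj₂ oR = realization-cast refl (sym b≡′) refl (Descending.descendingExtension m″ K (suc r) (s≤s z≤n) (odd-below R≤x oR) (odd-gap R≤x oR) r refl)
    where
    b≡′ : b ≡ K * x + r
    b≡′ = ℕ.suc-injective (trans b≡ (ℕ.+-suc (K * x) r))

  columns-after : ∀ i′ → suc (suc i′) < x → suc i′ + suc (m″ ∸ suc i′) ≡ suc m″
  columns-after i′ j<x = trans (ℕ.+-suc (suc i′) (m″ ∸ suc i′)) (cong suc (ℕ.m+[n∸m]≡n (ℕ.≤-pred (ℕ.≤-pred j<x))))

  columns-between : ∀ i′ → suc (suc i′) < x → m″ ∸ suc i′ + suc i′ ≡ m″
  columns-between i′ j<x = ℕ.m∸n+n≡m (ℕ.≤-pred (ℕ.≤-pred j<x))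

  descending-dirs : ∀ i′ → suc (suc i′) < x → isEven (suc (suc i′)) ≡ false →
    dirDescending x (suc (suc i′)) ≡ false × dirDescending x (suc i′) ≡ true
  descending-dirs i′ j<x oj = trans (isEven-∸ x (suc (suc i′)) (ℕ.<⇒≤ j<x) even) oj
                            , trans (isEven-∸ x (suc i′) (ℕ.<⇒≤ (ℕ.<-trans (ℕ.n<1+n _) j<x)) even) (isEven-pred (suc i′) oj)

  below-top : ∀ j t′ K r → j + suc t′ ≡ K * x + suc r → j ≤ K * x + r
  below-top j t′ K r jt≡ = subst (j ≤_) (ℕ.suc-injective (trans (sym (ℕ.+-suc j t′)) (trans jt≡ (ℕ.+-suc (K * x) r)))) (ℕ.m≤m+n j t′)

  longSteps : ∀ j t → 2 ≤ j → j < x → isEven t ≡ true → Realization x x t j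
  longSteps (suc zero)     t (s≤s ()) _ _
  longSteps (suc (suc i′)) t _ j<x et with divide⁺ (suc m″) (suc (suc i′) + t) (s≤s z≤n)
  ... | K , R , jt≡ , 1≤R , R≤x with Bool-cases (isEven R)
  ...   | inj₁ eR = Ascending.ascendingSplice (suc m″) K R R≤x (ascending-ok eR) (suc i′) (m″ ∸ suc i′) t
                      (cong suc (columns-after i′ j<x)) (trans (isEven-dividend (suc (suc i′)) t K et jt≡) eR) (sym jt≡)
  ...   | inj₂ oR = Descending.descendingSplice m″ K R 1≤R (odd-below R≤x oR) (odd-gap R≤x oR) i′ (m″ ∸ suc i′) t
                      (columns-between i′ j<x) (proj₁ dirs) (proj₂ dirs) (sym jt≡)
    where
    dirs : dirDescending x (suc (suc i′)) ≡ false × dirDescending x (suc i′) ≡ true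
    dirs = descending-dirs i′ j<x (trans (isEven-dividend (suc (suc i′)) t K et jt≡) oR)

  longSteps⁺ : ∀ j t′ → 2 ≤ j → j < x → isEven t′ ≡ false → Realization x (suc x) t′ (suc j)
  longSteps⁺ (suc zero)     t′ (s≤s ()) _ _
  longSteps⁺ (suc (suc i′)) t′ _ j<x ot with divide⁺ (suc m″) (suc (suc i′) + suc t′) (s≤s z≤n)
  ... | K , suc r , jt≡ , _ , R≤x with Bool-cases (isEven (suc r))
  ...   | inj₁ eR = Ascending.ascendingSpliceExtension (suc m″) K (suc r) R≤x (ascending-ok eR) (suc i′) (m″ ∸ suc i′) t′ r
                      (cong suc (columns-after i′ j<x)) (trans (isEven-dividend (suc (suc i′)) (suc t′) K (cong not ot) jt≡) eR) (sym jt≡) refl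
                      (below-top (suc (suc i′)) t′ K r jt≡)
  ...   | inj₂ oR = Descending.descendingSpliceExtension m″ K (suc r) (s≤s z≤n) (odd-below R≤x oR) (odd-gap R≤x oR) i′ (m″ ∸ suc i′) t′ r
                      (columns-between i′ j<x) (proj₁ dirs) (proj₂ dirs) (sym jt≡) refl (below-top (suc (suc i′)) t′ K r jt≡)
    where
    dirs : dirDescending x (suc (suc i′)) ≡ false × dirDescending x (suc i′) ≡ true
    dirs = descending-dirs i′ j<x (trans (isEven-dividend (suc (suc i′)) (suc t′) K (cong not ot) jt≡) oR)

  odd⇒positive : ∀ {b} → isEven b ≡ false → 1 ≤ b
  odd⇒positive {suc b} _ = s≤s z≤n

  -- The snakes do not cover ρ = 2 with b odd, nor ρ = x with b even.
  ones≤x+1 : ∀ b ρ → ρ ≤ x → (ρ ≡ 2 → isEven b ≡ true) → (ρ ≡ x → isEven b ≡ false) → ∃ λ a → a ≤ suc x × Realization x a b ρ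
  ones≤x+1 zero    zero _ _ _ = 0 , z≤n , trivialRealization
  ones≤x+1 (suc b) zero _ _ _ = suc m″ , ℕ.≤-trans (ℕ.n≤1+n (suc m″)) (ℕ.n≤1+n x) , noLongSteps (suc b) (s≤s z≤n)
  ones≤x+1 b 1 _ _ _ = x , ℕ.n≤1+n x , oneLongStep b
  ones≤x+1 b 2 ρ≤x two full = x , ℕ.n≤1+n x , longSteps 2 b (s≤s (s≤s z≤n)) (ℕ.≤∧≢⇒< ρ≤x (λ 2≡x → parity-≢ {b} {b} (two refl) (full 2≡x) refl)) (two refl)
  ones≤x+1 b (suc (suc (suc ρ))) ρ≤x _ full with Bool-cases (isEven b)
  ... | inj₁ eb = x , ℕ.n≤1+n x , longSteps (suc (suc (suc ρ))) b (s≤s (s≤s z≤n)) (ℕ.≤∧≢⇒< ρ≤x (λ ρ≡x → parity-≢ {b} {b} eb (full ρ≡x) refl)) eb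
  ... | inj₂ ob = suc x , ℕ.≤-refl , longSteps⁺ (suc (suc ρ)) b (s≤s (s≤s z≤n)) ρ≤x ob

  relax : ∀ {b c k k′} → k ≤ k′ → (∃ λ a → a ≤ k × Realization x a b c) → ∃ λ a → a ≤ k′ × Realization x a b c
  relax k≤k′ (a , a≤k , r) = a , ℕ.≤-trans a≤k k≤k′ , r

  longRows+2 : ∀ q → PerfectRealization x x 0 (q * suc x + 2)
  longRows+2 q = perfectDescending (suc m″) q even (s≤s z≤n)

  longRows : ∀ q → PerfectRealization x x 0 (q * suc x + suc x)
  longRows q = perfectAscending x q even

  suc-x≤2x-1 : suc x ≤ x + suc m″
  suc-x≤2x-1 = subst (_≤ x + suc m″) (ℕ.+-comm x 1) (ℕ.+-monoʳ-≤ x (s≤s z≤n))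

  -- The two obstructions of ones≤x+1 are avoided by a perfect block with two (x + 1)-steps, or by the
  -- zigzag tail, which needs x steps x.
  ones≤2x-1 : ∀ b ρ → ρ ≤ x → (ρ ≡ x → x ≤ b) → ∃ λ a → a ≤ x + suc m″ × Realization x a b ρ
  ones≤2x-1 b ρ ρ≤x enough with Bool-cases (isEven b) | ρ ℕ.≟ 2 | ρ ℕ.≟ x
  ... | inj₂ ob | yes refl | _        = x + suc m″ , ℕ.≤-refl , glue (longRows+2 0) (noLongSteps b (odd⇒positive ob))
  ... | inj₂ ob | no ρ≢2   | _        = relax suc-x≤2x-1 (ones≤x+1 b ρ ρ≤x (⊥-elim ∘ ρ≢2) (λ _ → ob))
  ... | inj₁ eb | _        | yes refl = suc x , suc-x≤2x-1 ,
    realization-cast refl (ℕ.m+[n∸m]≡n (enough refl)) (ℕ.+-comm (suc m″) 1) (glue (perfectZigzagTail m″) (oneLongStep (b ∸ x)))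
  ... | inj₁ eb | _        | no ρ≢x   = relax suc-x≤2x-1 (ones≤x+1 b ρ ρ≤x (λ _ → eb) (⊥-elim ∘ ρ≢x))

  prependLongRows : ∀ q {b ρ} → (∃ λ a → a ≤ suc x × Realization x a b ρ) → ∃ λ a → a ≤ x + suc x × Realization x a b (q * suc x + ρ)
  prependLongRows zero     (a , a≤ , r) = a , ℕ.≤-trans a≤ (ℕ.m≤n+m (suc x) x) , r
  prependLongRows (suc q) {ρ = ρ} (a , a≤ , r) =
    x + a , ℕ.+-monoʳ-≤ x a≤ , realization-cast refl refl (cong (_+ ρ) (ℕ.+-comm (q * suc x) (suc x))) (glue (longRows q) r)

  -- Full rows of x + 1 steps x + 1 go into one perfect block, which also absorbs two more of them to
  -- avoid the obstructions of ones≤x+1.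
  ones≤2x+1 : ∀ b q ρ → ρ ≤ x → ∃ λ a → a ≤ x + suc x × Realization x a b (q * suc x + ρ)
  ones≤2x+1 b q ρ ρ≤x with Bool-cases (isEven b) | ρ ℕ.≟ 2 | ρ ℕ.≟ x
  ... | inj₂ ob | yes refl | _        = x + suc m″ , ℕ.+-monoʳ-≤ x (ℕ.≤-trans (ℕ.n≤1+n _) (ℕ.n≤1+n _)) ,
    realization-cast refl refl (ℕ.+-identityʳ _) (glue (longRows+2 q) (noLongSteps b (odd⇒positive ob)))
  ... | inj₂ ob | no ρ≢2   | _        = prependLongRows q (ones≤x+1 b ρ ρ≤x (⊥-elim ∘ ρ≢2) (λ _ → ob))
  ... | inj₁ eb | _        | yes refl with ones≤x+1 b m″ (ℕ.≤-trans (ℕ.n≤1+n m″) (ℕ.n≤1+n _)) (λ _ → eb) (λ m″≡x → ⊥-elim (ℕ.<-irrefl m″≡x (ℕ.≤-trans (ℕ.n<1+n m″) (ℕ.n≤1+n _))))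
  ...   | a , a≤ , r = x + a , ℕ.+-monoʳ-≤ x a≤ , realization-cast refl refl (ℕ.+-assoc (q * suc x) 2 m″) (glue (longRows+2 q) r)
  ones≤2x+1 b q ρ ρ≤x | inj₁ eb | _ | no ρ≢x = prependLongRows q (ones≤x+1 b ρ ρ≤x (λ _ → eb) (⊥-elim ∘ ρ≢x))

  zigzagBands : ∀ β {a b c} → Realization x a b c → Realization x a (β * x + b) (β * suc x + c)
  zigzagBands zero    r = r
  zigzagBands (suc β) {b = b} {c} r = realization-cast refl (sym (ℕ.+-assoc x (β * x) b)) (sym (ℕ.+-assoc (suc x) (β * suc x) c))
    (glue (perfectZigzag x) (zigzagBands β r))

  realization-3x-1≤a : ∀ a b c → x + x + suc m″ ≤ a → Realization x a b c
  realization-3x-1≤a a b c a≥ =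
    let (a′ , a′≤ , r) = ones≤2x+1 b (c / suc x) (c % suc x) (ℕ.≤-pred (m%n<n c (suc x)))
    in  padOnes a (ℕ.≤-trans a′≤ (ℕ.≤-trans bound a≥)) (realization-cast refl refl c≡ r)
    where
    c≡ : c / suc x * suc x + c % suc x ≡ c
    c≡ = trans (ℕ.+-comm _ (c % suc x)) (sym (m≡m%n+[m/n]*n c (suc x)))
    bound : x + suc x ≤ x + x + suc m″
    bound = subst (_≤ x + x + suc m″) (sym (trans (ℕ.+-suc x x) (ℕ.+-comm 1 (x + x)))) (ℕ.+-monoʳ-≤ (x + x) (s≤s z≤n))

  realization-c+2x-1≤a : ∀ a b c → c + (x + suc m″) ≤ a → Realization x a b c
  realization-c+2x-1≤a a b c a≥ with c ℕ.<? x
  ... | yes c<x =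
    let (a′ , a′≤ , r) = ones≤2x-1 b c (ℕ.<⇒≤ c<x) (λ c≡x → ⊥-elim (ℕ.<-irrefl c≡x c<x))
    in  padOnes a (ℕ.≤-trans a′≤ (ℕ.≤-trans (ℕ.m≤n+m _ c) a≥)) r
  ... | no c≮x = realization-3x-1≤a a b c
    (ℕ.≤-trans (ℕ.≤-reflexive (ℕ.+-assoc x x (suc m″))) (ℕ.≤-trans (ℕ.+-monoˡ-≤ (x + suc m″) (ℕ.≮⇒≥ c≮x)) a≥))

  -- Each zigzag band uses x steps x and x + 1 steps x + 1; c ≤ b leaves enough x-steps for the remainder.
  realization-c≤b : ∀ a b c → c ≤ b → x + suc m″ ≤ a → Realization x a b c
  realization-c≤b a b c c≤b a≥ =
    let (a′ , a′≤ , r) = ones≤2x-1 (b ∸ β * x) ρ ρ≤x enough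
    in  padOnes a (ℕ.≤-trans a′≤ a≥) (realization-cast refl (ℕ.m+[n∸m]≡n βx≤b) c≡ (zigzagBands β r))
    where
    β ρ : ℕ
    β = c / suc x
    ρ = c % suc x
    ρ≤x : ρ ≤ x
    ρ≤x = ℕ.≤-pred (m%n<n c (suc x))
    split : ∀ β ρ x → β + ρ + β * x ≡ ρ + β * suc x
    split = solve-∀
    c≤b′ : β + ρ + β * x ≤ b
    c≤b′ = subst (_≤ b) (trans (m≡m%n+[m/n]*n c (suc x)) (sym (split β ρ x))) c≤b
    βx≤b : β * x ≤ b
    βx≤b = ℕ.≤-trans (ℕ.m≤n+m (β * x) (β + ρ)) c≤b′
    c≡ : β * suc x + ρ ≡ c
    c≡ = trans (ℕ.+-comm (β * suc x) ρ) (sym (m≡m%n+[m/n]*n c (suc x)))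
    enough : ρ ≡ x → x ≤ b ∸ β * x
    enough ρ≡x = subst (_≤ b ∸ β * x) ρ≡x (ℕ.≤-trans (ℕ.m≤n+m ρ β) (ℕ.m+n≤o⇒m≤o∸n (β + ρ) c≤b′))

theorem3p16 : (x a b c : ℕ) → 4 ≤ x → 2 ∣ x →
    ((3 * x ∸ 1 ≤ a) ⊎ (c + 2 * x ∸ 1 ≤ a) ⊎ (c ≤ b × 2 * x ∸ 1 ≤ a)) →
    Σ (List ℕ) (λ xs → StandardLinearRealization (L1xx1 x a b c) xs)
theorem3p16 (suc (suc m″)) a b c (s≤s (s≤s _)) (divides q x≡q*2) hyp = toStandard (realize hyp)
  where
  open EvenModulus m″ (trans (cong isEven x≡q*2) (isEven-*-even q 2 refl))
  2x-1≡ : 2 * x ∸ 1 ≡ x + suc m″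
  2x-1≡ = lemma m″
    where
    lemma : ∀ m″ → suc m″ + (suc (suc m″) + 0) ≡ suc (suc m″) + suc m″
    lemma = solve-∀
  3x-1≡ : 3 * x ∸ 1 ≡ x + x + suc m″
  3x-1≡ = lemma m″
    where
    lemma : ∀ m″ → suc m″ + (suc (suc m″) + (suc (suc m″) + 0)) ≡ suc (suc m″) + suc (suc m″) + suc m″
    lemma = solve-∀
  realize : (3 * x ∸ 1 ≤ a) ⊎ (c + 2 * x ∸ 1 ≤ a) ⊎ (c ≤ b × 2 * x ∸ 1 ≤ a) → Realization x a b c
  realize (inj₁ a≥)                = realization-3x-1≤a a b c (subst (_≤ a) 3x-1≡ a≥)
  realize (inj₂ (inj₁ a≥))         = realization-c+2x-1≤a a b c (subst (_≤ a) (trans (ℕ.+-∸-assoc c {2 * x} (s≤s z≤n)) (cong (c +_) 2x-1≡)) a≥)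
  realize (inj₂ (inj₂ (c≤b , a≥))) = realization-c≤b a b c c≤b (subst (_≤ a) 2x-1≡ a≥)
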